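{- Let $n\ge 7$ be odd. There exists a positive constant $c_1$ depending only on $n$ such that for every positive integer $N$ with $|\mathcal{L}_n(N)|>0$ we have $|\mathcal{L}_n(N)|\ge c_1N^{\frac{3}{n-1}}$, and for every positive integer $N$ with $|\mathcal{L}_{\ge n}(N)|>0$ we have $|\mathcal{L}_{\ge n}(N)|\ge c_1N^{\frac{3}{n-1}}$.
   Context: For integers $A,B$ the Lucas sequence $U$ is $U_0=0$, $U_1=1$, $U_n=AU_{n-1}-BU_{n-2}$ $(n\ge2)$; with $\alpha,\beta$ the roots of $x^2-Ax+B$, $U$ is non-degenerate if $AB\neq0$ and $\alpha/\beta$ is not a root of unity. $\mathcal{L}_n(N)$ is the set of integers $x$ with $0\le x\le N$ and $x=|U_n|$ for some non-degenerate Lucas sequence $U$, and $\mathcal{L}_{\ge n}(N)=\bigcup_{m\ge n}\mathcal{L}_m(N)$. -}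

module Defs where

open import Data.Nat using (ℕ; zero; suc; _≤_; _∸_)
open import Data.Integer using (ℤ; _+_; _-_; _*_; ∣_∣; +_)
open import Data.Product using (Σ; ∃; _×_; _,_; proj₁; proj₂)
open import Data.Sum using (_⊎_)
open import Relation.Binary.PropositionalEquality using (_≡_; _≢_)
open import Relation.Nullary using (¬_)

Upair : ℤ → ℤ → ℕ → ℤ × ℤ
Upair A B zero = (+ 0 , + 1)
Upair A B (suc k) with Upair A B k
... | (u , v) = (v , A * v - B * u)

U : ℤ → ℤ → ℕ → ℤ
U A B k = proj₁ (Upair A B k)

disc : ℤ → ℤ → ℤ
disc A B = A * A - + 4 * B

-- (A + √D)^k = X_k + Y_k √D  (coordinates (X_k , Y_k)), so that
-- 2^k α^k = X_k + Y_k √D and 2^k β^k = X_k - Y_k √D.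
sqrtPow : ℤ → ℤ → ℕ → ℤ × ℤ
sqrtPow A B zero = (+ 1 , + 0)
sqrtPow A B (suc k) with sqrtPow A B k
... | (x , y) = (A * x + disc A B * y , x + A * y)

-- α^k = β^k  iff  Y_k √D = 0  iff  D = 0 or Y_k = 0
PowEq : ℤ → ℤ → ℕ → Set
PowEq A B k = disc A B ≡ + 0 ⊎ proj₂ (sqrtPow A B k) ≡ + 0

-- α/β is a root of unity (β ≠ 0 since B ≠ 0): α^k = β^k for some k ≥ 1
RatioRootOfUnity : ℤ → ℤ → Set
RatioRootOfUnity A B = Σ ℕ λ k → 1 ≤ k × PowEq A B k

NonDegenerate : ℤ → ℤ → Set
NonDegenerate A B = A ≢ + 0 × B ≢ + 0 × ¬ RatioRootOfUnity A B

InL : ℕ → ℕ → ℕ → Set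
InL n N x = x ≤ N × Σ ℤ λ A → Σ ℤ λ B → NonDegenerate A B × ∣ U A B n ∣ ≡ x

InLge : ℕ → ℕ → ℕ → Set
InLge n N x = Σ ℕ λ m → n ≤ m × InL m N x

module Submission where

-- For n = 2k + 1 take B = -b < 0, so that u_n(A, b) is a positive form of degree k in A² and b, and
-- let A ≤ c N^{1/2k}, b ≤ c N^{1/k}: about N^{3/2k} pairs, all with u_n ≤ N.  It suffices that, after
-- discarding at most half of the pairs, each value is attained boundedly often.
--
-- Let q = p^v be a prime power dividing u_n(A, b), with A, b coprime and p ∤ n.  By Lagrange and Hensel
-- (the roots of u_n modulo p are simple) the ratio A² : b takes at most k values modulo q.  Suppose
-- that the prime-power components of m which are ≤ z = N^δ multiply to at most c N^{1/k}.  The other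
-- components are boundedly many, and two pairs with value m and the same ratio modulo each of them
-- have A² b′ ≡ A′² b modulo a number ≥ m / (c N^{1/k}).  As k ≥ 3, this exceeds both sides if b ≍ N^{1/k},
-- so A² b′ = A′² b and the pairs are equal.  Hence m is attained at most k^{O(1)} times.
--
-- The condition on m holds for most pairs: over z consecutive b, the product of the components ≤ z of
-- u_n(A, b) is at most (z!)^{2k}, since each q ≤ z divides at most 2k⌊z/q⌋ of these values.

open import Defs
open import Data.Nat as ℕ using (ℕ; zero; suc)
import Data.Nat.Properties as ℕₚ
import Data.Nat.Divisibility as ℕᵈ
open import Data.Nat.Coprimality as Coprimality using (Coprime; coprime?; coprime-Bézout; coprime-divisor; gcd≡1⇒coprime)
open import Data.Nat.DivMod using (_/_; _%_; m/n*n≤m; m≡m%n+[m/n]*n; m%n<n; m≥n⇒m/n>0)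
open import Data.Nat.GCD using (module Bézout; gcd; gcd[m,n]∣m; gcd[m,n]∣n)
open import Data.Nat.ListAction using (product)
open import Data.Nat.Primality using (Prime; euclidsLemma; prime?; prime⇒irreducible; prime⇒nonZero; prime⇒nonTrivial; ¬prime[1])
open import Data.Nat.Primality.Factorisation using (factorise; PrimeFactorisation)
import Data.Nat.Tactic.RingSolver as ℕSolver
open import Data.Integer as ℤ using (ℤ; +_; -_; ∣_∣)
import Data.Integer.Properties as ℤₚ
open import Data.Integer.Divisibility.Signed using (divides; ∣m∣n⇒∣m+n; ∣m∣n⇒∣m-n; ∣m⇒∣-m; ∣m+n∣m⇒∣n; ∣m+n∣n⇒∣m; ∣n⇒∣m*n; ∣m⇒∣m*n; ∣⇒∣ᵤ; ∣ᵤ⇒∣; ∣-trans) renaming (_∣_ to _∣ᶻ_)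
open import Data.Integer.Tactic.RingSolver using (solve-∀)
open import Data.List using (List; []; _∷_; _++_; length; map; filter; downFrom; cartesianProduct)
import Data.List.Properties as Listₚ
open import Data.List.Relation.Unary.All as All using (All; []; _∷_)
import Data.List.Relation.Unary.All.Properties as Allₚ
open import Data.List.Relation.Unary.AllPairs as AllPairs using (AllPairs; []; _∷_)
import Data.List.Relation.Unary.AllPairs.Properties as AllPairsₚ
open import Data.List.Relation.Unary.Unique.Propositional using (Unique)
import Data.List.Relation.Unary.Unique.Propositional.Properties as Uniqueₚ
open import Data.Product using (Σ; _×_; _,_; proj₁; proj₂)
open import Data.Sum using (_⊎_; inj₁; inj₂)
open import Data.Empty using (⊥; ⊥-elim)
open import Data.Unit using (⊤; tt)
open import Function using (_∘_)
open import Relation.Binary.Definitions using (Decidable; tri<; tri≈; tri>)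
open import Relation.Binary.PropositionalEquality
open import Relation.Nullary using (¬_; Dec; yes; no; ¬?; _×-dec_)

-- Coprimality and `p ∤ n` are arranged by congruences: `A` is a multiple of `M` and `b ≡ 1` modulo
-- `M`, where `M` is divisible by `n` and by every number up to 16. A common factor of `A` and `b`
-- is then prime to `M`, so it exceeds 16, and the pairs having one are at most a quarter of the
-- box. Each component used to sort the pairs multiplies the number of classes by `k`, so only
-- boundedly many may be used; the components above `z` qualify because all values are below a fixed
-- power of `z`. The price is that the remaining modulus must still exceed every nonzero `Δ` on the
-- box. These are at most `2 M³ H²`, while a value is at least `b³ ≥ (M H)³`, so a loss of up to
-- `H / 4` is affordable. That loss is controlled on average: over a block of `z` values of `b` the
-- product of the small parts is at most `(z ^ z) ^ (2k)`, an exponent of `2k` per pair. Exceeding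
-- `z ^ (8k)`, four times that exponent, is possible for at most another quarter of the pairs, and
-- `H = 4 z ^ (8k)` is chosen to match.

module _ where

  -- The Lucas polynomials: homogeneity and Taylor expansion in `b`.

  open import Data.Integer using (_+_; _-_; _*_; _^_)
  open import Data.Nat using (_≤_)

  -- The sign of the last term makes this U A (- b).
  lucas : ℤ → ℤ → ℕ → ℤ
  lucas A b 0 = + 0
  lucas A b 1 = + 1
  lucas A b (suc (suc j)) = A * lucas A b (suc j) + b * lucas A b j

  -- With `A` of weight 1 and `b` of weight 2, the `j`-th term is homogeneous of weight `j - 1`; the
  -- extra factor `l` on both sides avoids the subtraction.
  lucas-scale : ∀ l A b j → l * lucas (l * A) (l * l * b) j ≡ (l ^ j) * lucas A b j
  lucas-scale l A b 0 = trans (ℤₚ.*-zeroʳ l) (sym (ℤₚ.*-zeroʳ (l ^ 0)))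
  lucas-scale l A b 1 = sym (ℤₚ.*-identityʳ (l ^ 1))
  lucas-scale l A b (suc (suc j)) = begin
    l * (l * A * u₁ + l * l * b * u₀)        ≡⟨ regroup l A b u₁ u₀ ⟩
    l * A * (l * u₁) + l * l * b * (l * u₀)  ≡⟨ cong₂ (λ x y → l * A * x + l * l * b * y) (lucas-scale l A b (suc j)) (lucas-scale l A b j) ⟩
    l * A * (l * l ^ j * v₁) + l * l * b * (l ^ j * v₀) ≡⟨ collect l A b (l ^ j) v₁ v₀ ⟩
    l * (l * l ^ j) * (A * v₁ + b * v₀) ∎
    where
    open ≡-Reasoning
    u₁ = lucas (l * A) (l * l * b) (suc j)
    u₀ = lucas (l * A) (l * l * b) j
    v₁ = lucas A b (suc j)
    v₀ = lucas A b j
    regroup : ∀ l A b u₁ u₀ → l * (l * A * u₁ + l * l * b * u₀) ≡ l * A * (l * u₁) + l * l * b * (l * u₀)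
    regroup = solve-∀
    collect : ∀ l A b p v₁ v₀ → l * A * (l * p * v₁) + l * l * b * (p * v₀) ≡ l * (l * p) * (A * v₁ + b * v₀)
    collect = solve-∀

  lucas-∂ : ℤ → ℤ → ℕ → ℤ
  lucas-∂ A b 0 = + 0
  lucas-∂ A b 1 = + 0
  lucas-∂ A b (suc (suc j)) = A * lucas-∂ A b (suc j) + b * lucas-∂ A b j + lucas A b j

  -- The quadratic Taylor remainder in `b`. Its recurrence is read off from the coefficient of `h²`
  -- in the recurrence at `b + h`.
  lucas-remainder : ℤ → ℤ → ℤ → ℕ → ℤ
  lucas-remainder A b h 0 = + 0
  lucas-remainder A b h 1 = + 0
  lucas-remainder A b h (suc (suc j)) =
    A * lucas-remainder A b h (suc j) + (b + h) * lucas-remainder A b h j + lucas-∂ A b j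

  lucas-taylor : ∀ A b h j →
    lucas A (b + h) j ≡ lucas A b j + h * (lucas-∂ A b j + h * lucas-remainder A b h j)
  lucas-taylor A b h 0 = base h
    where
    base : ∀ h → + 0 ≡ + 0 + h * (+ 0 + h * + 0)
    base = solve-∀
  lucas-taylor A b h 1 = base h
    where
    base : ∀ h → + 1 ≡ + 1 + h * (+ 0 + h * + 0)
    base = solve-∀
  lucas-taylor A b h (suc (suc j)) = begin
    A * lucas A (b + h) (suc j) + (b + h) * lucas A (b + h) j
      ≡⟨ cong₂ (λ x y → A * x + (b + h) * y) (lucas-taylor A b h (suc j)) (lucas-taylor A b h j) ⟩
    A * (u₁ + h * (w₁ + h * r₁)) + (b + h) * (u₀ + h * (w₀ + h * r₀))
      ≡⟨ expand A b h u₁ w₁ r₁ u₀ w₀ r₀ ⟩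
    (A * u₁ + b * u₀) + h * ((A * w₁ + b * w₀ + u₀) + h * (A * r₁ + (b + h) * r₀ + w₀)) ∎
    where
    open ≡-Reasoning
    u₁ = lucas A b (suc j)
    u₀ = lucas A b j
    w₁ = lucas-∂ A b (suc j)
    w₀ = lucas-∂ A b j
    r₁ = lucas-remainder A b h (suc j)
    r₀ = lucas-remainder A b h j
    expand : ∀ A b h u₁ w₁ r₁ u₀ w₀ r₀ →
      A * (u₁ + h * (w₁ + h * r₁)) + (b + h) * (u₀ + h * (w₀ + h * r₀)) ≡
      (A * u₁ + b * u₀) + h * ((A * w₁ + b * w₀ + u₀) + h * (A * r₁ + (b + h) * r₀ + w₀))
    expand = solve-∀

  -- The classical (A² + 4b) ∂u_n/∂b = n v_{n-1} - 2 u_n, with v_{n-1} = 2 u_n - A u_{n-1}.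
  lucas-∂-identity : ∀ A b j →
    (A * A + + 4 * b) * lucas-∂ A b (suc j) ≡
    + suc j * (+ 2 * lucas A b (suc j) - A * lucas A b j) - + 2 * lucas A b (suc j)
  lucas-∂-identity A b 0 = base A b
    where
    base : ∀ A b → (A * A + + 4 * b) * + 0 ≡ + 1 * (+ 2 * + 1 - A * + 0) - + 2 * + 1
    base = solve-∀
  lucas-∂-identity A b 1 = base A b
    where
    base : ∀ A b → (A * A + + 4 * b) * (A * + 0 + b * + 0 + + 0) ≡
      + 2 * (+ 2 * (A * + 1 + b * + 0) - A * + 1) - + 2 * (A * + 1 + b * + 0)
    base = solve-∀
  lucas-∂-identity A b (suc (suc j)) = begin
    D * (A * w₂ + b * w₁ + u₁)
      ≡⟨ distribute D A b w₂ w₁ u₁ ⟩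
    A * (D * w₂) + b * (D * w₁) + D * u₁
      ≡⟨ cong₂ (λ x y → A * x + b * y + D * u₁) (lucas-∂-identity A b (suc j)) (lucas-∂-identity A b j) ⟩
    A * ((+ 1 + t) * (+ 2 * (A * u₁ + b * u₀) - A * u₁) - + 2 * (A * u₁ + b * u₀)) +
      b * (t * (+ 2 * u₁ - A * u₀) - + 2 * u₁) + D * u₁
      ≡⟨ collect A b t u₁ u₀ ⟩
    (+ 2 + t) * (+ 2 * (A * (A * u₁ + b * u₀) + b * u₁) - A * (A * u₁ + b * u₀)) -
      + 2 * (A * (A * u₁ + b * u₀) + b * u₁) ∎
    where
    open ≡-Reasoning
    D = A * A + + 4 * b
    t = + suc j
    w₂ = lucas-∂ A b (suc (suc j))
    w₁ = lucas-∂ A b (suc j)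
    u₁ = lucas A b (suc j)
    u₀ = lucas A b j
    distribute : ∀ D A b w₂ w₁ u₁ → D * (A * w₂ + b * w₁ + u₁) ≡ A * (D * w₂) + b * (D * w₁) + D * u₁
    distribute = solve-∀
    collect : ∀ A b t u₁ u₀ →
      A * ((+ 1 + t) * (+ 2 * (A * u₁ + b * u₀) - A * u₁) - + 2 * (A * u₁ + b * u₀)) +
        b * (t * (+ 2 * u₁ - A * u₀) - + 2 * u₁) + (A * A + + 4 * b) * u₁ ≡
      (+ 2 + t) * (+ 2 * (A * (A * u₁ + b * u₀) + b * u₁) - A * (A * u₁ + b * u₀)) -
        + 2 * (A * (A * u₁ + b * u₀) + b * u₁)
    collect = solve-∀

  -- Divisibility by a prime, and simplicity of the roots.

  prime∤1 : ∀ {p} → Prime p → ¬ (+ p ∣ᶻ + 1)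
  prime∤1 pp d = ¬prime1 (ℕᵈ.∣1⇒≡1 (∣⇒∣ᵤ d)) pp
    where
    ¬prime1 : ∀ {p} → p ≡ 1 → Prime p → ⊥
    ¬prime1 refl q = Data.Nat.Primality.¬prime[1] q

  euclid : ∀ {p} → Prime p → ∀ x y → + p ∣ᶻ x * y → + p ∣ᶻ x ⊎ + p ∣ᶻ y
  euclid pp x y d with euclidsLemma ∣ x ∣ ∣ y ∣ pp (subst (_ ℕᵈ.∣_) (ℤₚ.abs-* x y) (∣⇒∣ᵤ d))
  ... | inj₁ e = inj₁ (∣ᵤ⇒∣ e)
  ... | inj₂ e = inj₂ (∣ᵤ⇒∣ e)

  ∤-* : ∀ {p} → Prime p → ∀ {x y} → ¬ (+ p ∣ᶻ x) → ¬ (+ p ∣ᶻ y) → ¬ (+ p ∣ᶻ x * y)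
  ∤-* pp {x} {y} ∤x ∤y d with euclid pp x y d
  ... | inj₁ e = ∤x e
  ... | inj₂ e = ∤y e

  ∣p^n⇒∣p : ∀ {p} → Prime p → ∀ x j → + p ∣ᶻ x ^ j → + p ∣ᶻ x
  ∣p^n⇒∣p pp x zero d = ⊥-elim (prime∤1 pp d)
  ∣p^n⇒∣p pp x (suc j) d with euclid pp x (x ^ j) d
  ... | inj₁ e = e
  ... | inj₂ e = ∣p^n⇒∣p pp x j e

  -- Induction on `v`: once `x = q p ^ v`, dividing by `p ^ v` leaves `p ∣ q y`, and Euclid's lemma
  -- passes the last factor to `q`.
  prime-power-cancel : ∀ {p} → Prime p → ∀ v x y → + (p ℕ.^ v) ∣ᶻ x * y → ¬ (+ p ∣ᶻ y) → + (p ℕ.^ v) ∣ᶻ x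
  prime-power-cancel pp zero x y d ∤y = divides x (sym (ℤₚ.*-identityʳ x))
  prime-power-cancel {p} pp (suc v) x y d@(divides s xy≡) ∤y
    with prime-power-cancel pp v x y (∣-trans (divides (+ p) (ℤₚ.pos-* p (p ℕ.^ v))) d) ∤y
  ... | divides q refl with euclid pp q y (divides s qy≡)
    where
    open ≡-Reasoning
    instance p^v≢0 = ℕₚ.m^n≢0 p v {{Data.Nat.Primality.prime⇒nonZero pp}}
    P = + (p ℕ.^ v)
    rearrange : ∀ q y P → q * y * P ≡ q * P * y
    rearrange = solve-∀
    qy≡ : q * y ≡ s * + p
    qy≡ = ℤₚ.*-cancelʳ-≡ (q * y) (s * + p) P (begin
      q * y * P         ≡⟨ rearrange q y P ⟩
      q * P * y         ≡⟨ xy≡ ⟩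
      s * + (p ℕ.* p ℕ.^ v) ≡⟨ cong (s *_) (ℤₚ.pos-* p (p ℕ.^ v)) ⟩
      s * (+ p * P)     ≡⟨ ℤₚ.*-assoc s (+ p) P ⟨
      s * + p * P ∎)
  ... | inj₂ e = ⊥-elim (∤y e)
  ... | inj₁ (divides r refl) = divides r (trans (ℤₚ.*-assoc r (+ p) _) (cong (r *_) (sym (ℤₚ.pos-* p (p ℕ.^ v)))))

  -- Descent: a prime dividing two consecutive terms divides `b` times the term before them, and so
  -- on down to the term 1.
  ∤consecutive : ∀ {p} → Prime p → ∀ A b j → ¬ (+ p ∣ᶻ b) → + p ∣ᶻ lucas A b j → ¬ (+ p ∣ᶻ lucas A b (suc j))
  ∤consecutive pp A b zero ∤b d₀ d₁ = prime∤1 pp d₁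
  ∤consecutive pp A b (suc j) ∤b d₀ d₁
    with euclid pp b (lucas A b j) (∣m+n∣m⇒∣n d₁ (∣n⇒∣m*n A d₀))
  ... | inj₁ e = ∤b e
  ... | inj₂ e = ∤consecutive pp A b j ∤b e d₀

  ∣b⇒∣A : ∀ {p} → Prime p → ∀ A b j → + p ∣ᶻ b → + p ∣ᶻ lucas A b (suc j) → + p ∣ᶻ A
  ∣b⇒∣A pp A b zero d e = ⊥-elim (prime∤1 pp e)
  ∣b⇒∣A {p} pp A b (suc j) d e
    with euclid pp A (lucas A b (suc j)) (∣m+n∣n⇒∣m e (∣m⇒∣m*n (lucas A b j) d))
  ... | inj₁ f = f
  ... | inj₂ f = ∣b⇒∣A pp A b j d f

  double : ℕ → ℕ
  double zero = zero
  double (suc k) = suc (suc (double k))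

  odd : ℕ → ℕ
  odd k = suc (double k)

  -- Modulo `A` the term of index `2k + 1` is `b ^ k`. The odd index matters: terms of even index
  -- are divisible by `A`.
  ∣A⇒∣b : ∀ {p} → Prime p → ∀ A b k → + p ∣ᶻ A → + p ∣ᶻ lucas A b (odd k) → + p ∣ᶻ b
  ∣A⇒∣b pp A b zero d e = ⊥-elim (prime∤1 pp e)
  ∣A⇒∣b pp A b (suc k) d e
    with euclid pp b (lucas A b (odd k)) (∣m+n∣m⇒∣n e (∣m⇒∣m*n (lucas A b (suc (odd k))) d))
  ... | inj₁ f = f
  ... | inj₂ f = ∣A⇒∣b pp A b k d f

  -- If `u_n` and its derivative both vanished modulo `p`, `lucas-∂-identity` would leave
  -- `n A u_{n-1} ≡ 0`, whose three factors are units.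
  ∤lucas-∂ : ∀ {p} → Prime p → ∀ A b j → ¬ (+ p ∣ᶻ + suc j) → ¬ (+ p ∣ᶻ A) → ¬ (+ p ∣ᶻ b) →
    + p ∣ᶻ lucas A b (suc j) → ¬ (+ p ∣ᶻ lucas-∂ A b (suc j))
  ∤lucas-∂ {p} pp A b j ∤n ∤A ∤b d e = ∤-* pp ∤n (∤-* pp ∤A λ d₀ → ∤consecutive pp A b j ∤b d₀ d) n∣
    where
    u₁ = lucas A b (suc j)
    u₀ = lucas A b j
    n = + suc j
    rearrange : ∀ n A u₁ u₀ → n * (A * u₀) ≡ (+ 2 * n - + 2) * u₁ - (n * (+ 2 * u₁ - A * u₀) - + 2 * u₁)
    rearrange = solve-∀
    n∣ : + p ∣ᶻ n * (A * u₀)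
    n∣ = subst (+ p ∣ᶻ_) (sym (rearrange n A u₁ u₀))
      (∣m∣n⇒∣m-n (∣n⇒∣m*n (+ 2 * n - + 2) d)
        (subst (+ p ∣ᶻ_) (lucas-∂-identity A b j) (∣n⇒∣m*n (A * A + + 4 * b) e)))

  -- Hensel's lemma in the variable b, the roots of u_n modulo p being simple.
  hensel : ∀ {p} → Prime p → ∀ v A b h j → ¬ (+ p ∣ᶻ + suc j) → ¬ (+ p ∣ᶻ A) → ¬ (+ p ∣ᶻ b) → + p ∣ᶻ h →
    + p ∣ᶻ lucas A b (suc j) → + (p ℕ.^ v) ∣ᶻ lucas A b (suc j) → + (p ℕ.^ v) ∣ᶻ lucas A (b + h) (suc j) →
    + (p ℕ.^ v) ∣ᶻ h
  hensel {p} pp v A b h j ∤n ∤A ∤b p∣h d₀ d₁ d₂ =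
    -- The Taylor expansion gives `p ^ v ∣ h (w + h r)`, and `w + h r ≡ w` is a unit modulo `p`.
    prime-power-cancel pp v h (w + h * r)
      (∣m+n∣m⇒∣n (subst (_ ∣ᶻ_) (lucas-taylor A b h (suc j)) d₂) d₁)
      (λ e → ∤lucas-∂ pp A b j ∤n ∤A ∤b d₀ (∣m+n∣n⇒∣m e (∣m⇒∣m*n r p∣h)))
    where
    w = lucas-∂ A b (suc j)
    r = lucas-remainder A b h (suc j)

  -- Polynomial functions of degree at most k, with coefficient c at degree k,
  -- characterised by their divided differences.
  Poly : ℕ → ℤ → (ℤ → ℤ) → Set
  Poly zero c f = ∀ x → f x ≡ c
  Poly (suc k) c f = ∀ x₀ → Σ (ℤ → ℤ) λ g → Poly k c g × (∀ x → f x ≡ f x₀ + (x - x₀) * g x)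

  poly-+ : ∀ k {c d f g} → Poly k c f → Poly k d g → Poly k (c + d) (λ x → f x + g x)
  poly-+ zero P Q x = cong₂ _+_ (P x) (Q x)
  poly-+ (suc k) {f = f} {g} P Q x₀ with P x₀ | Q x₀
  ... | f′ , P′ , f≡ | g′ , Q′ , g≡ = (λ x → f′ x + g′ x) , poly-+ k P′ Q′ ,
    λ x → trans (cong₂ _+_ (f≡ x) (g≡ x)) (regroup (f x₀) (g x₀) (x - x₀) (f′ x) (g′ x))
    where
    regroup : ∀ a b h c d → a + h * c + (b + h * d) ≡ a + b + h * (c + d)
    regroup = solve-∀

  poly-scale : ∀ k a {c f} → Poly k c f → Poly k (a * c) (λ x → a * f x)
  poly-scale zero a P x = cong (a *_) (P x)
  poly-scale (suc k) a {f = f} P x₀ with P x₀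
  ... | f′ , P′ , f≡ = (λ x → a * f′ x) , poly-scale k a P′ ,
    λ x → trans (cong (a *_) (f≡ x)) (regroup a (f x₀) (x - x₀) (f′ x))
    where
    regroup : ∀ a b h c → a * (b + h * c) ≡ a * b + h * (a * c)
    regroup = solve-∀

  poly-weaken : ∀ k {c f} → Poly k c f → Poly (suc k) (+ 0) f
  poly-weaken zero {c} {f} P x₀ = (λ _ → + 0) , (λ _ → refl) ,
    λ x → trans (trans (P x) (sym (P x₀))) (add0 (f x₀) (x - x₀))
    where
    add0 : ∀ a h → a ≡ a + h * + 0
    add0 = solve-∀
  poly-weaken (suc k) P x₀ with P x₀
  ... | f′ , P′ , f≡ = f′ , poly-weaken k P′ , f≡

  poly-shift : ∀ k {c f} → Poly k c f → Poly (suc k) c (λ x → x * f x)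
  poly-shift zero {c} {f} P x₀ = f , P ,
    λ x → trans (split x x₀ (f x)) (cong (λ y → x₀ * y + (x - x₀) * f x) (trans (P x) (sym (P x₀))))
    where
    split : ∀ x x₀ y → x * y ≡ x₀ * y + (x - x₀) * y
    split = solve-∀
  poly-shift (suc k) {c} {f} P x₀ with P x₀
  ... | f′ , P′ , f≡ = (λ x → f x + x₀ * f′ x) ,
    subst (λ d → Poly (suc k) d (λ x → f x + x₀ * f′ x)) (drop0 c x₀)
      (poly-+ (suc k) P (poly-scale (suc k) x₀ (poly-weaken k P′))) ,
    λ x → begin
      x * f x                                        ≡⟨ split x x₀ (f x) ⟩
      x₀ * f x + (x - x₀) * f x                      ≡⟨ cong (λ y → x₀ * y + (x - x₀) * f x) (f≡ x) ⟩
      x₀ * (f x₀ + (x - x₀) * f′ x) + (x - x₀) * f x ≡⟨ regroup x₀ (f x₀) (x - x₀) (f′ x) (f x) ⟩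
      x₀ * f x₀ + (x - x₀) * (f x + x₀ * f′ x)       ∎
    where
    open ≡-Reasoning
    split : ∀ x x₀ y → x * y ≡ x₀ * y + (x - x₀) * y
    split = solve-∀
    regroup : ∀ a b h c d → a * (b + h * c) + h * d ≡ a * b + h * (d + a * c)
    regroup = solve-∀
    drop0 : ∀ c a → c + a * + 0 ≡ c
    drop0 = solve-∀

  -- Both parities go through one induction. At odd index the leading coefficient 1 is inherited
  -- through the summand `b * _`; the even-index summand has lower degree and contributes 0 there.
  lucas-poly : ∀ A k → Poly k (+ 1) (λ b → lucas A b (odd k)) ×
    Σ ℤ λ c → Poly k c (λ b → lucas A b (suc (odd k)))
  lucas-poly A zero = (λ _ → refl) , A , λ b → base A b
    where
    base : ∀ A b → A * + 1 + b * + 0 ≡ A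
    base = solve-∀
  lucas-poly A (suc k) with lucas-poly A k
  ... | P , c , Q = P⁺ , _ , poly-+ (suc k) (poly-scale (suc k) A P⁺) (poly-shift k Q)
    where
    drop0 : ∀ a → a * + 0 + + 1 ≡ + 1
    drop0 = solve-∀
    P⁺ : Poly (suc k) (+ 1) (λ b → lucas A b (odd (suc k)))
    P⁺ = subst (λ d → Poly (suc k) d (λ b → lucas A b (odd (suc k)))) (drop0 A)
           (poly-+ (suc k) (poly-scale (suc k) A (poly-weaken k Q)) (poly-shift k P))

  -- Dividing out one root lowers the degree: the divided difference at `x` vanishes at the other
  -- roots, because their differences from `x` are units modulo `p`. For a monic polynomial the
  -- conclusion is absurd.
  lagrange : ∀ {p} → Prime p → ∀ k {c f} → Poly k c f → ∀ xs → All (λ x → + p ∣ᶻ f x) xs →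
    AllPairs (λ x y → ¬ + p ∣ᶻ x - y) xs → k ℕ.< length xs → + p ∣ᶻ c
  lagrange pp zero P (x ∷ xs) (d ∷ _) _ _ = subst (_ ∣ᶻ_) (P x) d
  lagrange {p} pp (suc k) {f = f} P (x ∷ xs) (d ∷ ds) (ns ∷ nss) (ℕ.s≤s lt) with P x
  ... | g , Q , f≡ = lagrange pp k Q xs (quotient xs ds ns) nss lt
    where
    swap-minus : ∀ x y → - (y - x) ≡ x - y
    swap-minus = solve-∀
    quotient : ∀ ys → All (λ y → + p ∣ᶻ f y) ys → All (λ y → ¬ + p ∣ᶻ x - y) ys → All (λ y → + p ∣ᶻ g y) ys
    quotient [] [] [] = []
    quotient (y ∷ ys) (e ∷ es) (m ∷ ms) with euclid pp (y - x) (g y) (∣m+n∣m⇒∣n (subst (+ p ∣ᶻ_) (f≡ y) e) d)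
    ... | inj₁ h = ⊥-elim (m (subst (+ p ∣ᶻ_) (swap-minus x y) (∣m⇒∣-m h)))
    ... | inj₂ h = h ∷ quotient ys es ms

  -- Primitive roots modulo prime powers and their ratios.

  prime∤⇒coprime : ∀ {p a} → Prime p → ¬ p ℕᵈ.∣ a → Coprime a p
  prime∤⇒coprime {p} {a} pp p∤a {d} (d∣a , d∣p) with prime⇒irreducible pp d∣p
  ... | inj₁ d≡1 = d≡1
  ... | inj₂ refl = ⊥-elim (p∤a d∣a)

  inverse : ∀ {p} → Prime p → ∀ a → ¬ + p ∣ᶻ + a → Σ ℤ λ c → + p ∣ᶻ c * + a - + 1
  inverse {p} pp a p∤a with coprime-Bézout (prime∤⇒coprime pp λ d → p∤a (∣ᵤ⇒∣ d))
  ... | Bézout.+- x y eq = + x , divides (+ y) (begin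
    + x * + a - + 1         ≡⟨ cong (_- + 1) (sym (ℤₚ.pos-* x a)) ⟩
    + (x ℕ.* a) - + 1       ≡⟨ cong (λ t → + t - + 1) (sym eq) ⟩
    + (1 ℕ.+ y ℕ.* p) - + 1 ≡⟨ cancel (+ (y ℕ.* p)) ⟩
    + (y ℕ.* p)             ≡⟨ ℤₚ.pos-* y p ⟩
    + y * + p               ∎)
    where
    open ≡-Reasoning
    cancel : ∀ t → + 1 + t - + 1 ≡ t
    cancel = solve-∀
  ... | Bézout.-+ x y eq = - + x , divides (- + y) (begin
    - + x * + a - + 1       ≡⟨ negate (+ x) (+ a) ⟩
    - (+ 1 + + x * + a)     ≡⟨ cong (λ t → - (+ 1 + t)) (sym (ℤₚ.pos-* x a)) ⟩
    - + (1 ℕ.+ x ℕ.* a)     ≡⟨ cong (λ t → - + t) eq ⟩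
    - + (y ℕ.* p)           ≡⟨ cong -_ (ℤₚ.pos-* y p) ⟩
    - (+ y * + p)           ≡⟨ ℤₚ.neg-distribˡ-* (+ y) (+ p) ⟩
    - + y * + p             ∎)
    where
    open ≡-Reasoning
    negate : ∀ x a → - x * a - + 1 ≡ - (+ 1 + x * a)
    negate = solve-∀

  lucas-cong : ∀ {p X Y} b j → p ∣ᶻ X - Y → p ∣ᶻ lucas X b j - lucas Y b j
  lucas-cong b 0 d = divides (+ 0) refl
  lucas-cong b 1 d = divides (+ 0) refl
  lucas-cong {p} {X} {Y} b (suc (suc j)) d =
    subst (p ∣ᶻ_) (sym (regroup X Y b (lucas X b (suc j)) (lucas Y b (suc j)) (lucas X b j) (lucas Y b j)))
      (∣m∣n⇒∣m+n (∣m∣n⇒∣m+n (∣n⇒∣m*n X (lucas-cong b (suc j) d)) (∣m⇒∣m*n (lucas Y b (suc j)) d))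
        (∣n⇒∣m*n b (lucas-cong b j d)))
    where
    regroup : ∀ X Y b x₁ y₁ x₀ y₀ →
      X * x₁ + b * x₀ - (Y * y₁ + b * y₀) ≡ X * (x₁ - y₁) + (X - Y) * y₁ + b * (x₀ - y₀)
    regroup = solve-∀

  -- Vanishes when A² : b and A′² : b′ are equal ratios, hence measures whether two pairs define
  -- the same root of the binary form u_n.
  Δ : ℕ × ℕ → ℕ × ℕ → ℤ
  Δ (A , b) (A′ , b′) = + A * + A * + b′ - + A′ * + A′ * + b

  PrimitiveRoot : ℕ → ℕ → ℕ → ℕ × ℕ → Set
  PrimitiveRoot p v k (A , b) = + (p ℕ.^ v) ∣ᶻ lucas (+ A) (+ b) (odd k) × ¬ (+ p ∣ᶻ + A × + p ∣ᶻ + b)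

  module _ {p : ℕ} (pp : Prime p) (v k : ℕ) where

    weaken-power : ∀ {x} → + (p ℕ.^ suc v) ∣ᶻ x → + p ∣ᶻ x
    weaken-power = ∣-trans (divides (+ (p ℕ.^ v)) (trans (cong +_ (ℕₚ.*-comm p (p ℕ.^ v))) (ℤₚ.pos-* (p ℕ.^ v) p)))

    root⇒∤A : ∀ A b → PrimitiveRoot p (suc v) k (A , b) → ¬ + p ∣ᶻ + A
    root⇒∤A A b (d , prim) e = prim (e , ∣A⇒∣b pp (+ A) (+ b) k e (weaken-power d))

    root⇒∤b : ∀ A b → PrimitiveRoot p (suc v) k (A , b) → ¬ + p ∣ᶻ + b
    root⇒∤b A b (d , prim) e = prim (∣b⇒∣A pp (+ A) (+ b) (double k) e (weaken-power d) , e)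

    scaled-root : ∀ l A b → ¬ + p ∣ᶻ l → ∀ v′ → + (p ℕ.^ v′) ∣ᶻ lucas A b (odd k) →
      + (p ℕ.^ v′) ∣ᶻ lucas (l * A) (l * l * b) (odd k)
    scaled-root l A b ∤l v′ d = prime-power-cancel pp v′ _ l
      (subst (_ ∣ᶻ_) (trans (sym (lucas-scale l A b (odd k))) (ℤₚ.*-comm l _)) (∣n⇒∣m*n (l ^ odd k) d)) ∤l

    -- Scaling `x` by `A′` and `y` by `A` gives both pairs the first coordinate `A A′`; their second
    -- coordinates then differ by exactly `Δ x y`, to which `hensel` applies.
    root-lift : ¬ + p ∣ᶻ + odd k → ∀ x y → PrimitiveRoot p (suc v) k x → PrimitiveRoot p (suc v) k y →
      + p ∣ᶻ Δ x y → + (p ℕ.^ suc v) ∣ᶻ Δ x y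
    root-lift ∤n x@(A , b) y@(A′ , b′) r r′ d =
      hensel pp (suc v) (+ A′ * + A) (+ A′ * + A′ * + b) (Δ x y) (double k) ∤n
        (∤-* pp ∤A′ ∤A) (∤-* pp (∤-* pp ∤A′ ∤A′) (root⇒∤b A b r)) d (weaken-power first) first second
      where
      ∤A = root⇒∤A A b r
      ∤A′ = root⇒∤A A′ b′ r′
      first : + (p ℕ.^ suc v) ∣ᶻ lucas (+ A′ * + A) (+ A′ * + A′ * + b) (odd k)
      first = scaled-root (+ A′) (+ A) (+ b) ∤A′ (suc v) (proj₁ r)
      cancel : ∀ A b A′ b′ → A * A * b′ ≡ A′ * A′ * b + (A * A * b′ - A′ * A′ * b)
      cancel = solve-∀
      second : + (p ℕ.^ suc v) ∣ᶻ lucas (+ A′ * + A) (+ A′ * + A′ * + b + Δ x y) (odd k)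
      second = subst₂ (λ X c → + (p ℕ.^ suc v) ∣ᶻ lucas X c (odd k)) (ℤₚ.*-comm (+ A) (+ A′))
        (cancel (+ A) (+ b) (+ A′) (+ b′)) (scaled-root (+ A) (+ A′) (+ b′) ∤A (suc v) (proj₁ r′))

    -- Scaling by an inverse `c` of `A` modulo `p` normalises the pair to `(1 , c² b)`, which turns
    -- a root of the binary form into a root of a polynomial in one variable.
    slope : ∀ x → PrimitiveRoot p (suc v) k x → Σ ℤ λ c → + p ∣ᶻ c * + proj₁ x - + 1 ×
      + p ∣ᶻ lucas (+ 1) (c * c * + proj₂ x) (odd k)
    slope (A , b) r with inverse pp A (root⇒∤A A b r)
    ... | c , d = c , d ,
      subst (+ p ∣ᶻ_) (minus-minus u₁ u₂)
        (∣m∣n⇒∣m-n scaled (lucas-cong (c * c * + b) (odd k) d))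
      where
      u₁ = lucas (c * + A) (c * c * + b) (odd k)
      u₂ = lucas (+ 1) (c * c * + b) (odd k)
      minus-minus : ∀ x y → x - (x - y) ≡ y
      minus-minus = solve-∀
      one : ∀ x → x - (x - + 1) ≡ + 1
      one = solve-∀
      ∤c : ¬ + p ∣ᶻ c
      ∤c e = prime∤1 pp (subst (+ p ∣ᶻ_) (one (c * + A)) (∣m∣n⇒∣m-n (∣m⇒∣m*n (+ A) e) d))
      p^1∣ : ∀ {x} → + p ∣ᶻ x → + (p ℕ.^ 1) ∣ᶻ x
      p^1∣ = subst (λ q → + q ∣ᶻ _) (sym (ℕₚ.*-identityʳ p))
      scaled : + p ∣ᶻ u₁
      scaled = subst (λ q → + q ∣ᶻ u₁) (ℕₚ.*-identityʳ p)
        (scaled-root c (+ A) (+ b) ∤c 1 (p^1∣ (weaken-power (proj₁ r))))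

    -- Modulo `p` one has `c A ≡ c′ A′ ≡ 1`, so `Δ` is a multiple of the difference of slopes. It is
    -- used in the contrapositive.
    slopes-differ : ∀ x y c c′ → + p ∣ᶻ c * + proj₁ x - + 1 → + p ∣ᶻ c′ * + proj₁ y - + 1 →
      + p ∣ᶻ c * c * + proj₂ x - c′ * c′ * + proj₂ y → + p ∣ᶻ Δ x y
    slopes-differ (A , b) (A′ , b′) c c′ d d′ e =
      subst (+ p ∣ᶻ_) (sym (expand (+ A) (+ b) (+ A′) (+ b′) c c′))
        (∣m∣n⇒∣m-n
          (∣m∣n⇒∣m-n (∣m⇒∣m*n ((c * + A + + 1) * (+ A′ * + A′ * + b)) d)
                     (∣m⇒∣m*n ((c′ * + A′ + + 1) * (+ A * + A * + b′)) d′))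
          (∣n⇒∣m*n (+ A * + A * (+ A′ * + A′)) e))
      where
      expand : ∀ A b A′ b′ c c′ → A * A * b′ - A′ * A′ * b ≡
        (c * A - + 1) * ((c * A + + 1) * (A′ * A′ * b)) - (c′ * A′ - + 1) * ((c′ * A′ + + 1) * (A * A * b′))
        - A * A * (A′ * A′) * (c * c * b - c′ * c′ * b′)
      expand = solve-∀

    -- By `root-lift`, pairs inequivalent modulo `p ^ suc v` are already inequivalent modulo `p`, so
    -- their slopes are distinct roots modulo `p` of a monic polynomial of degree `k`.
    roots-bounded : ¬ + p ∣ᶻ + odd k → ∀ xs → All (PrimitiveRoot p (suc v) k) xs →
      AllPairs (λ x y → ¬ + (p ℕ.^ suc v) ∣ᶻ Δ x y) xs → length xs ℕ.≤ k
    roots-bounded ∤n xs rs ds = subst (ℕ._≤ k) (lengths xs rs)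
      (ℕₚ.≮⇒≥ λ lt → prime∤1 pp (lagrange pp k (proj₁ (lucas-poly (+ 1) k)) (ρs xs rs)
        (vanish xs rs) (distinct xs rs ds) lt))
      where
      ρ : ∀ x → PrimitiveRoot p (suc v) k x → ℤ
      ρ x r = proj₁ (slope x r) * proj₁ (slope x r) * + proj₂ x
      ρs : ∀ xs → All (PrimitiveRoot p (suc v) k) xs → List ℤ
      ρs [] [] = []
      ρs (x ∷ xs) (r ∷ rs) = ρ x r ∷ ρs xs rs
      lengths : ∀ xs rs → length (ρs xs rs) ≡ length xs
      lengths [] [] = refl
      lengths (x ∷ xs) (r ∷ rs) = cong suc (lengths xs rs)
      vanish : ∀ xs rs → All (λ c → + p ∣ᶻ lucas (+ 1) c (odd k)) (ρs xs rs)
      vanish [] [] = []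
      vanish (x ∷ xs) (r ∷ rs) = proj₂ (proj₂ (slope x r)) ∷ vanish xs rs
      apart : ∀ x r xs rs → All (λ y → ¬ + (p ℕ.^ suc v) ∣ᶻ Δ x y) xs → All (λ c → ¬ + p ∣ᶻ ρ x r - c) (ρs xs rs)
      apart x r [] [] [] = []
      apart x r (y ∷ ys) (s ∷ ss) (n ∷ ns) =
        (λ e → n (root-lift ∤n x y r s (slopes-differ x y (proj₁ (slope x r)) (proj₁ (slope y s)) (proj₁ (proj₂ (slope x r))) (proj₁ (proj₂ (slope y s))) e)))
        ∷ apart x r ys ss ns
      distinct : ∀ xs rs → AllPairs (λ x y → ¬ + (p ℕ.^ suc v) ∣ᶻ Δ x y) xs →
        AllPairs (λ c d → ¬ + p ∣ᶻ c - d) (ρs xs rs)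
      distinct [] [] [] = []
      distinct (x ∷ xs) (r ∷ rs) (n ∷ ns) = apart x r xs rs n ∷ distinct xs rs ns

  -- `A²` times the wanted `Δ` is a combination of the two given ones, and `A` is a unit modulo `p`.
  Δ-trans : ∀ {p} → Prime p → ∀ v x {y y′} → ¬ + p ∣ᶻ + proj₁ x →
    + (p ℕ.^ v) ∣ᶻ Δ y x → + (p ℕ.^ v) ∣ᶻ Δ y′ x → + (p ℕ.^ v) ∣ᶻ Δ y y′
  Δ-trans {p} pp v (A , b) {A₁ , b₁} {A₂ , b₂} ∤A d d′ =
    prime-power-cancel pp v (Δ (A₁ , b₁) (A₂ , b₂)) (+ A * + A)
      (subst (+ (p ℕ.^ v) ∣ᶻ_) (identity (+ A) (+ b) (+ A₁) (+ b₁) (+ A₂) (+ b₂))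
        (∣m∣n⇒∣m-n (∣n⇒∣m*n (+ A₂ * + A₂) d) (∣n⇒∣m*n (+ A₁ * + A₁) d′)))
      (∤-* pp ∤A ∤A)
    where
    identity : ∀ A b A₁ b₁ A₂ b₂ →
      A₂ * A₂ * (A₁ * A₁ * b - A * A * b₁) - A₁ * A₁ * (A₂ * A₂ * b - A * A * b₂) ≡
      (A₁ * A₁ * b₂ - A₂ * A₂ * b₁) * (A * A)
    identity = solve-∀

  Δ-progression : ∀ A M t e → - Δ (A , suc (M ℕ.* (t ℕ.+ e))) (A , suc (M ℕ.* t)) ≡ + e * (+ A * + A * + M)
  Δ-progression A M t e = trans
    (cong₂ (λ x y → - (+ A * + A * x - + A * + A * y)) (suc-* t)
      (trans (suc-* (t ℕ.+ e)) (cong (λ x → + 1 + + M * x) (ℤₚ.pos-+ t e))))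
    (collapse (+ A) (+ M) (+ t) (+ e))
    where
    suc-* : ∀ t → + suc (M ℕ.* t) ≡ + 1 + + M * + t
    suc-* t = trans (ℤₚ.pos-+ 1 (M ℕ.* t)) (cong (λ x → + 1 + x) (ℤₚ.pos-* M t))
    collapse : ∀ A M t e → - (A * A * (+ 1 + M * t) - A * A * (+ 1 + M * (t + e))) ≡ e * (A * A * M)
    collapse = solve-∀

  ∣Δ∣≤ : ∀ {A b A′ b′} B → A ℕ.* A ℕ.* b′ ℕ.≤ B → A′ ℕ.* A′ ℕ.* b ℕ.≤ B → ∣ Δ (A , b) (A′ , b′) ∣ ℕ.≤ B
  Δ≡0⇒ : ∀ {A b A′ b′} → Δ (A , b) (A′ , b′) ≡ + 0 → A ℕ.* A ℕ.* b′ ≡ A′ ℕ.* A′ ℕ.* b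

  private
    pos-*³ : ∀ x y → + x * + x * + y ≡ + (x ℕ.* x ℕ.* y)
    pos-*³ x y = sym (trans (ℤₚ.pos-* (x ℕ.* x) y) (cong (_* + y) (ℤₚ.pos-* x x)))

  ∣Δ∣≤ {A} {b} {A′} {b′} B le le′ = subst (ℕ._≤ B) (cong ∣_∣ (sym eq))
    (ℕₚ.≤-trans (ℤₚ.∣m⊝n∣≤m⊔n (A ℕ.* A ℕ.* b′) (A′ ℕ.* A′ ℕ.* b)) (ℕₚ.⊔-lub le le′))
    where
    eq : Δ (A , b) (A′ , b′) ≡ A ℕ.* A ℕ.* b′ ℤ.⊖ A′ ℕ.* A′ ℕ.* b
    eq = trans (cong₂ _-_ (pos-*³ A b′) (pos-*³ A′ b)) (ℤₚ.m-n≡m⊖n (A ℕ.* A ℕ.* b′) (A′ ℕ.* A′ ℕ.* b))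

  Δ≡0⇒ {A} {b} {A′} {b′} eq = ℤₚ.+-injective
    (trans (sym (pos-*³ A b′)) (trans (ℤₚ.i-j≡0⇒i≡j (+ A * + A * + b′) (+ A′ * + A′ * + b) eq) (pos-*³ A′ b)))

  -- Values as natural numbers, and non-degeneracy.

  lucasℕ : ℕ → ℕ → ℕ → ℕ
  lucasℕ A b 0 = 0
  lucasℕ A b 1 = 1
  lucasℕ A b (suc (suc j)) = A ℕ.* lucasℕ A b (suc j) ℕ.+ b ℕ.* lucasℕ A b j

  lucas-+ : ∀ A b j → lucas (+ A) (+ b) j ≡ + lucasℕ A b j
  lucas-+ A b 0 = refl
  lucas-+ A b 1 = refl
  lucas-+ A b (suc (suc j)) = sym (trans (ℤₚ.pos-+ (A ℕ.* lucasℕ A b (suc j)) (b ℕ.* lucasℕ A b j))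
    (cong₂ _+_ (trans (ℤₚ.pos-* A _) (cong (+ A *_) (sym (lucas-+ A b (suc j)))))
               (trans (ℤₚ.pos-* b _) (cong (+ b *_) (sym (lucas-+ A b j))))))

  Upair-lucas : ∀ A b j → Upair A (- b) j ≡ (lucas A b j , lucas A b (suc j))
  Upair-lucas A b zero = refl
  Upair-lucas A b (suc j) rewrite Upair-lucas A b j =
    cong (lucas A b (suc j) ,_) (regroup A b (lucas A b (suc j)) (lucas A b j))
    where
    regroup : ∀ A b v u → A * v - - b * u ≡ A * v + b * u
    regroup = solve-∀

  ∣U∣-lucasℕ : ∀ A b j → ∣ U (+ A) (- + b) j ∣ ≡ lucasℕ A b j
  ∣U∣-lucasℕ A b j = cong ∣_∣ (trans (cong proj₁ (Upair-lucas (+ A) (+ b) j)) (lucas-+ A b j))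

  disc-pos : ∀ A b → disc (+ A) (- + b) ≡ + (A ℕ.* A ℕ.+ 4 ℕ.* b)
  disc-pos A b = begin
    + A * + A - + 4 * - + b      ≡⟨ flip-sign (+ A) (+ b) ⟩
    + A * + A + + 4 * + b        ≡⟨ cong₂ _+_ (ℤₚ.pos-* A A) (ℤₚ.pos-* 4 b) ⟨
    + (A ℕ.* A) + + (4 ℕ.* b)    ≡⟨ ℤₚ.pos-+ (A ℕ.* A) (4 ℕ.* b) ⟨
    + (A ℕ.* A ℕ.+ 4 ℕ.* b)      ∎
    where
    open ≡-Reasoning
    flip-sign : ∀ A b → A * A - + 4 * - b ≡ A * A + + 4 * b
    flip-sign = solve-∀

  -- For `B = - b` the discriminant is `A² + 4b`, so nothing cancels in the recurrence and each
  -- second coordinate is at least the preceding first one. This excludes `α ^ j = β ^ j` for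
  -- `j ≥ 1`.
  sqrtPow-pos : ∀ {A} b → 1 ≤ A → ∀ j → Σ ℕ λ x → Σ ℕ λ y →
    sqrtPow (+ A) (- + b) j ≡ (+ x , + y) × 1 ≤ x × (1 ≤ j → 1 ≤ y)
  sqrtPow-pos b 1≤A zero = 1 , 0 , refl , ℕₚ.≤-refl , λ ()
  sqrtPow-pos {A} b 1≤A (suc j) with sqrtPow (+ A) (- + b) j | sqrtPow-pos {A} b 1≤A j
  ... | _ | x , y , refl , 1≤x , _ =
    A ℕ.* x ℕ.+ D ℕ.* y , x ℕ.+ A ℕ.* y ,
    cong₂ _,_ X≡ (trans (cong (λ t → + x + t) (sym (ℤₚ.pos-* A y))) (sym (ℤₚ.pos-+ x (A ℕ.* y)))) ,
    ℕₚ.≤-trans (ℕₚ.*-mono-≤ 1≤A 1≤x) (ℕₚ.m≤m+n (A ℕ.* x) (D ℕ.* y)) , λ _ → ℕₚ.≤-trans 1≤x (ℕₚ.m≤m+n x (A ℕ.* y))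
    where
    D = A ℕ.* A ℕ.+ 4 ℕ.* b
    X≡ : + A * + x + disc (+ A) (- + b) * + y ≡ + (A ℕ.* x ℕ.+ D ℕ.* y)
    X≡ = trans (cong (λ d → + A * + x + d * + y) (disc-pos A b))
      (sym (trans (ℤₚ.pos-+ (A ℕ.* x) (D ℕ.* y)) (cong₂ _+_ (ℤₚ.pos-* A x) (ℤₚ.pos-* D y))))

  nonDegenerate : ∀ {A b} → 1 ≤ A → 1 ≤ b → NonDegenerate (+ A) (- + b)
  nonDegenerate {A@(suc _)} {b@(suc _)} 1≤A 1≤b = (λ ()) , (λ ()) , no-root
    where
    no-root : ¬ RatioRootOfUnity (+ A) (- + b)
    no-root (j , 1≤j , inj₁ D≡0) with trans (sym (disc-pos A b)) D≡0
    ... | ()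
    no-root (j , 1≤j , inj₂ Y≡0) with sqrtPow-pos {A} b 1≤A j
    ... | x , y , eq , _ , 1≤y = ℕₚ.<⇒≢ (1≤y 1≤j) (sym (ℤₚ.+-injective (trans (sym (cong proj₂ eq)) Y≡0)))

open import Data.Nat using (_+_; _*_; _^_; _∸_; _!; _≤_; _<_; _≤?_; _<?_; _≟_; z≤n; s≤s; NonZero; >-nonZero)

-- Finite sums, products and counting

module _ {ℓ} {P : Set ℓ} where
  𝟙 : Dec P → ℕ
  𝟙 (yes _) = 1
  𝟙 (no _) = 0

  𝟙-yes : (d : Dec P) → P → 𝟙 d ≡ 1
  𝟙-yes (yes _) _ = refl
  𝟙-yes (no ¬p) p = ⊥-elim (¬p p)

  𝟙-no : (d : Dec P) → ¬ P → 𝟙 d ≡ 0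
  𝟙-no (yes p) ¬p = ⊥-elim (¬p p)
  𝟙-no (no _) _ = refl

𝟙-⇔ : ∀ {a b} {P : Set a} {Q : Set b} (d : Dec P) (e : Dec Q) → (P → Q) → (Q → P) → 𝟙 d ≡ 𝟙 e
𝟙-⇔ (yes p) e f g = sym (𝟙-yes e (f p))
𝟙-⇔ (no ¬p) e f g = sym (𝟙-no e (¬p ∘ g))

∑ : ℕ → (ℕ → ℕ) → ℕ
∑ zero f = 0
∑ (suc n) f = ∑ n f + f n

∏ : ℕ → (ℕ → ℕ) → ℕ
∏ zero f = 1
∏ (suc n) f = ∏ n f * f n

∑-mono : ∀ n {f g} → (∀ i → i < n → f i ≤ g i) → ∑ n f ≤ ∑ n g
∑-mono zero le = ℕₚ.≤-refl
∑-mono (suc n) le = ℕₚ.+-mono-≤ (∑-mono n λ i i<n → le i (ℕₚ.m<n⇒m<1+n i<n)) (le n ℕₚ.≤-refl)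

∑-zero : ∀ n → ∑ n (λ _ → 0) ≡ 0
∑-zero zero = refl
∑-zero (suc n) = trans (ℕₚ.+-identityʳ _) (∑-zero n)

∑-const : ∀ n c → ∑ n (λ _ → c) ≡ n * c
∑-const zero c = refl
∑-const (suc n) c = trans (cong (_+ c) (∑-const n c)) (ℕₚ.+-comm (n * c) c)

interchange : ∀ a b c d → (a + b) + (c + d) ≡ (a + c) + (b + d)
interchange = ℕSolver.solve-∀

*-interchange : ∀ a b c d → (a * b) * (c * d) ≡ (a * c) * (b * d)
*-interchange = ℕSolver.solve-∀

∑-+ : ∀ n f g → ∑ n (λ i → f i + g i) ≡ ∑ n f + ∑ n g
∑-+ zero f g = refl
∑-+ (suc n) f g = trans (cong (_+ (f n + g n)) (∑-+ n f g)) (interchange (∑ n f) (∑ n g) (f n) (g n))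

∑-*ˡ : ∀ n c f → ∑ n (λ i → c * f i) ≡ c * ∑ n f
∑-*ˡ zero c f = sym (ℕₚ.*-zeroʳ c)
∑-*ˡ (suc n) c f = trans (cong (_+ c * f n) (∑-*ˡ n c f)) (sym (ℕₚ.*-distribˡ-+ c (∑ n f) (f n)))

∑-swap : ∀ m n (f : ℕ → ℕ → ℕ) → ∑ m (λ i → ∑ n (f i)) ≡ ∑ n (λ j → ∑ m (λ i → f i j))
∑-swap zero n f = sym (∑-zero n)
∑-swap (suc m) n f = trans (cong (_+ ∑ n (f m)) (∑-swap m n f)) (sym (∑-+ n (λ j → ∑ m (λ i → f i j)) (f m)))

∑-split : ∀ m n f → ∑ (m + n) f ≡ ∑ m f + ∑ n (λ i → f (m + i))
∑-split m zero f = trans (cong (λ t → ∑ t f) (ℕₚ.+-identityʳ m)) (sym (ℕₚ.+-identityʳ _))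
∑-split m (suc n) f = trans (cong (λ t → ∑ t f) (ℕₚ.+-suc m n))
  (trans (cong (_+ f (m + n)) (∑-split m n f)) (ℕₚ.+-assoc (∑ m f) _ _))

∑-monoˡ : ∀ {m n} f → m ≤ n → ∑ m f ≤ ∑ n f
∑-monoˡ {m} {n} f m≤n = subst (λ t → ∑ m f ≤ ∑ t f) (ℕₚ.m+[n∸m]≡n m≤n)
  (subst (∑ m f ≤_) (sym (∑-split m (n ∸ m) f)) (ℕₚ.m≤m+n (∑ m f) _))

∑-term : ∀ n f {i} → i < n → f i ≤ ∑ n f
∑-term n f {i} i<n = ℕₚ.≤-trans (ℕₚ.m≤n+m (f i) (∑ i f)) (∑-monoˡ f i<n)

∏-mono : ∀ n {f g} → (∀ i → i < n → f i ≤ g i) → ∏ n f ≤ ∏ n g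
∏-mono zero le = ℕₚ.≤-refl
∏-mono (suc n) le = ℕₚ.*-mono-≤ (∏-mono n λ i i<n → le i (ℕₚ.m<n⇒m<1+n i<n)) (le n ℕₚ.≤-refl)

∏-cong : ∀ n {f g} → (∀ i → i < n → f i ≡ g i) → ∏ n f ≡ ∏ n g
∏-cong zero eq = refl
∏-cong (suc n) eq = cong₂ _*_ (∏-cong n λ i i<n → eq i (ℕₚ.m<n⇒m<1+n i<n)) (eq n ℕₚ.≤-refl)

∏-const : ∀ n c → ∏ n (λ _ → c) ≡ c ^ n
∏-const zero c = refl
∏-const (suc n) c = trans (cong (_* c) (∏-const n c)) (ℕₚ.*-comm (c ^ n) c)

∏-* : ∀ n f g → ∏ n (λ i → f i * g i) ≡ ∏ n f * ∏ n g
∏-* zero f g = refl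
∏-* (suc n) f g = trans (cong (_* (f n * g n)) (∏-* n f g)) (*-interchange (∏ n f) (∏ n g) (f n) (g n))

∏-swap : ∀ m n (f : ℕ → ℕ → ℕ) → ∏ m (λ i → ∏ n (f i)) ≡ ∏ n (λ j → ∏ m (λ i → f i j))
∏-swap zero n f = sym (trans (∏-const n 1) (ℕₚ.^-zeroˡ n))
∏-swap (suc m) n f = trans (cong (_* ∏ n (f m)) (∏-swap m n f)) (sym (∏-* n (λ j → ∏ m (λ i → f i j)) (f m)))

∏-split : ∀ m n f → ∏ (m + n) f ≡ ∏ m f * ∏ n (λ i → f (m + i))
∏-split m zero f = trans (cong (λ t → ∏ t f) (ℕₚ.+-identityʳ m)) (sym (ℕₚ.*-identityʳ _))
∏-split m (suc n) f = trans (cong (λ t → ∏ t f) (ℕₚ.+-suc m n))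
  (trans (cong (_* f (m + n)) (∏-split m n f)) (ℕₚ.*-assoc (∏ m f) _ _))

∏-^-∑ : ∀ n c f → ∏ n (λ i → c ^ f i) ≡ c ^ ∑ n f
∏-^-∑ zero c f = refl
∏-^-∑ (suc n) c f = trans (cong (_* c ^ f n) (∏-^-∑ n c f)) (sym (ℕₚ.^-distribˡ-+-* c (∑ n f) (f n)))

*-^-distrib : ∀ a b n → (a * b) ^ n ≡ a ^ n * b ^ n
*-^-distrib a b zero = refl
*-^-distrib a b (suc n) = trans (cong (a * b *_) (*-^-distrib a b n)) (*-interchange a b (a ^ n) (b ^ n))

∏-^ : ∀ n e f → ∏ n (λ i → f i ^ e) ≡ ∏ n f ^ e
∏-^ zero e f = sym (ℕₚ.^-zeroˡ e)
∏-^ (suc n) e f = trans (cong (_* f n ^ e) (∏-^ n e f)) (sym (*-^-distrib (∏ n f) (f n) e))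

∏-update-out : ∀ n i {f g} → (∀ j → j ≢ i → f j ≡ g j) → n ≤ i → ∏ n f ≡ ∏ n g
∏-update-out n i eq n≤i = ∏-cong n λ j j<n → eq j (ℕₚ.<⇒≢ (ℕₚ.<-≤-trans j<n n≤i))

∏-update : ∀ n i c {f g} → (∀ j → j ≢ i → f j ≡ g j) → f i ≡ c * g i → i < n → ∏ n f ≡ c * ∏ n g
∏-update (suc n) i c {f} {g} eq eqᵢ i<1+n with i ≟ n
... | yes refl = begin
  ∏ n f * f n         ≡⟨ cong₂ _*_ (∏-update-out n n eq ℕₚ.≤-refl) eqᵢ ⟩
  ∏ n g * (c * g n) ≡⟨ ℕₚ.*-assoc (∏ n g) c (g n) ⟨
  ∏ n g * c * g n   ≡⟨ cong (_* g n) (ℕₚ.*-comm (∏ n g) c) ⟩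
  c * ∏ n g * g n   ≡⟨ ℕₚ.*-assoc c (∏ n g) (g n) ⟩
  c * (∏ n g * g n) ∎
  where open ≡-Reasoning
... | no i≢n = trans
  (cong₂ _*_ (∏-update n i c eq eqᵢ (ℕₚ.≤∧≢⇒< (ℕₚ.≤-pred i<1+n) i≢n)) (eq n (i≢n ∘ sym)))
  (ℕₚ.*-assoc c (∏ n g) (g n))

module _ {ℓ} {P : ℕ → Set ℓ} where
  count : ℕ → (∀ i → Dec (P i)) → ℕ
  count n P? = ∑ n (λ i → 𝟙 (P? i))

  count-filter : ∀ n (P? : ∀ i → Dec (P i)) → count n P? ≡ length (filter P? (downFrom n))
  count-filter zero P? = refl
  count-filter (suc n) P? with P? n
  ... | yes _ = trans (ℕₚ.+-comm _ 1) (cong suc (count-filter n P?))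
  ... | no _ = trans (ℕₚ.+-identityʳ _) (count-filter n P?)

  -- The counted indices form a strictly decreasing list, so it suffices to bound such lists.
  count-bound : ∀ n κ (P? : ∀ i → Dec (P i)) →
    (∀ xs → All P xs → AllPairs (λ i j → j < i × i < n) xs → length xs ≤ κ) → count n P? ≤ κ
  count-bound n κ P? bound = subst (_≤ κ) (sym (count-filter n P?))
    (bound (filter P? (downFrom n)) (Allₚ.all-filter P? (downFrom n))
      (AllPairsₚ.filter⁺ P? (AllPairsₚ.applyDownFrom⁺₁ (λ i → i) n _,_)))

windows : ∀ f q κ → (∀ c → ∑ q (λ i → f (c + i)) ≤ κ) → ∀ t c → ∑ (t * q) (λ i → f (c + i)) ≤ t * κ
windows f q κ le zero c = z≤n
windows f q κ le (suc t) c = begin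
  ∑ (q + t * q) (λ i → f (c + i)) ≡⟨ ∑-split q (t * q) _ ⟩
  ∑ q (λ i → f (c + i)) + ∑ (t * q) (λ i → f (c + (q + i)))
    ≤⟨ ℕₚ.+-mono-≤ (le c) (∑-mono (t * q) λ i _ → ℕₚ.≤-reflexive (cong f (sym (ℕₚ.+-assoc c q i)))) ⟩
  κ + ∑ (t * q) (λ i → f (c + q + i)) ≤⟨ ℕₚ.+-monoʳ-≤ κ (windows f q κ le t (c + q)) ⟩
  κ + t * κ ∎
  where open ℕₚ.≤-Reasoning

∏-windows : ∀ f q κ → (∀ c → ∏ q (λ i → f (c + i)) ≤ κ) → ∀ t c → ∏ (t * q) (λ i → f (c + i)) ≤ κ ^ t
∏-windows f q κ le zero c = ℕₚ.≤-refl
∏-windows f q κ le (suc t) c = begin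
  ∏ (q + t * q) (λ i → f (c + i)) ≡⟨ ∏-split q (t * q) _ ⟩
  ∏ q (λ i → f (c + i)) * ∏ (t * q) (λ i → f (c + (q + i)))
    ≤⟨ ℕₚ.*-mono-≤ (le c) (∏-mono (t * q) λ i _ → ℕₚ.≤-reflexive (cong f (sym (ℕₚ.+-assoc c q i)))) ⟩
  κ * ∏ (t * q) (λ i → f (c + q + i)) ≤⟨ ℕₚ.*-monoʳ-≤ κ (∏-windows f q κ le t (c + q)) ⟩
  κ * κ ^ t ∎
  where open ℕₚ.≤-Reasoning

m<[1+m/n]*n : ∀ m n .{{_ : NonZero n}} → m < suc (m / n) * n
m<[1+m/n]*n m n = begin-strict
  m                     ≡⟨ m≡m%n+[m/n]*n m n ⟩
  m % n + m / n * n <⟨ ℕₚ.+-monoˡ-< (m / n * n) (m%n<n m n) ⟩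
  n + m / n * n     ∎
  where open ℕₚ.≤-Reasoning

windows-/ : ∀ f q κ .{{_ : NonZero q}} → (∀ c → ∑ q (λ i → f (c + i)) ≤ κ) →
  ∀ n c → ∑ n (λ i → f (c + i)) ≤ suc (n / q) * κ
windows-/ f q κ le n c =
  ℕₚ.≤-trans (∑-monoˡ _ (ℕₚ.<⇒≤ (m<[1+m/n]*n n q))) (windows f q κ le (suc (n / q)) c)

multiples : ∀ q .{{_ : NonZero q}} t → t ≤ count (t * q) (λ i → q ℕᵈ.∣? suc i)
multiples q zero = z≤n
multiples q@(suc r) (suc t) = begin
  suc t                       ≡⟨ ℕₚ.+-comm 1 t ⟩
  t + 1                     ≤⟨ ℕₚ.+-mono-≤ (multiples q t) last ⟩
  ∑ (t * q) f + ∑ q (λ i → f (t * q + i)) ≡⟨ ∑-split (t * q) q f ⟨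
  ∑ (t * q + q) f         ≡⟨ cong (λ m → ∑ m f) (ℕₚ.+-comm (t * q) q) ⟩
  ∑ (q + t * q) f         ∎
  where
  open ℕₚ.≤-Reasoning
  f : ℕ → ℕ
  f i = 𝟙 (q ℕᵈ.∣? suc i)
  q∣ : q ℕᵈ.∣ suc (t * q + r)
  q∣ = subst (q ℕᵈ.∣_) (ℕₚ.+-suc (t * q) r) (ℕᵈ.∣m∣n⇒∣m+n (ℕᵈ.n∣m*n t) ℕᵈ.∣-refl)
  last : 1 ≤ ∑ q (λ i → f (t * q + i))
  last = ℕₚ.≤-trans (ℕₚ.≤-reflexive (sym (𝟙-yes (q ℕᵈ.∣? _) q∣)))
    (∑-term q (λ i → f (t * q + i)) ℕₚ.≤-refl)

-- Bounding lists by classes and by fibres.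

length-filter-split : ∀ {a ℓ} {A : Set a} {P : A → Set ℓ} (P? : ∀ x → Dec (P x)) xs →
  length xs ≡ length (filter P? xs) + length (filter (¬? ∘ P?) xs)
length-filter-split P? [] = refl
length-filter-split P? (x ∷ xs) with P? x
... | yes _ = cong suc (length-filter-split P? xs)
... | no _ = trans (cong suc (length-filter-split P? xs)) (sym (ℕₚ.+-suc _ _))

AllPairs-map-All : ∀ {a ℓ₁ ℓ₂ ℓ₃} {A : Set a} {Q : A → Set ℓ₁} {R : A → A → Set ℓ₂} {S : A → A → Set ℓ₃} →
  (∀ {x y} → Q x → Q y → R x y → S x y) → ∀ {xs} → All Q xs → AllPairs R xs → AllPairs S xs
AllPairs-map-All f [] [] = []
AllPairs-map-All f (q ∷ qs) (rs ∷ rss) =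
  All.zipWith (λ (q′ , r) → f q q′ r) (qs , rs) ∷ AllPairs-map-All f qs rss

module _ {a ℓ₁ ℓ₂ ℓ₃} {A : Set a} {V : A → Set ℓ₁} {R : A → A → Set ℓ₂} {D : A → A → Set ℓ₃}
         (R? : Decidable R) (k c : ℕ)
         (spread : ∀ xs → All V xs → AllPairs (λ x y → ¬ R x y) xs → length xs ≤ k)
         (class : ∀ x xs → V x → All V xs → All (λ y → R y x) xs → AllPairs D xs → length xs ≤ c) where

  private
    -- `j` is the number of representatives that may still be chosen; at `j = 0` one more would
    -- contradict `spread`.
    greedy : ∀ j reps xs → All V reps → AllPairs (λ x y → ¬ R x y) reps → k ≤ length reps + j →
      All V xs → AllPairs D xs → All (λ x → All (λ r → ¬ R x r) reps) xs → length xs ≤ j * c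
    greedy j reps [] _ _ _ _ _ _ = z≤n
    greedy zero reps (x ∷ xs) vs ns le (v ∷ _) _ (m ∷ _) =
      ⊥-elim (ℕₚ.<⇒≱ (spread (x ∷ reps) (v ∷ vs) (m ∷ ns)) (subst (k ≤_) (ℕₚ.+-identityʳ _) le))
    greedy (suc j) reps xs′@(x ∷ _) vs ns le ws@(w ∷ _) ds ms@(m ∷ _) = begin
      length xs′                 ≡⟨ length-filter-split (λ y → R? y x) xs′ ⟩
      length near + length far ≤⟨ ℕₚ.+-mono-≤
        (class x near w (Allₚ.filter⁺ R[-,x]? ws) (Allₚ.all-filter R[-,x]? xs′) (AllPairsₚ.filter⁺ R[-,x]? ds))
        (greedy j (x ∷ reps) far (w ∷ vs) (m ∷ ns) (subst (k ≤_) (ℕₚ.+-suc _ j) le)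
          (Allₚ.filter⁺ (¬? ∘ R[-,x]?) ws) (AllPairsₚ.filter⁺ (¬? ∘ R[-,x]?) ds)
          (All.zipWith (λ (n , ns) → n ∷ ns) (Allₚ.all-filter (¬? ∘ R[-,x]?) xs′ , Allₚ.filter⁺ (¬? ∘ R[-,x]?) ms))) ⟩
      suc j * c ∎
      where
      open ℕₚ.≤-Reasoning
      R[-,x]? = λ y → R? y x
      near = filter R[-,x]? xs′
      far = filter (¬? ∘ R[-,x]?) xs′

  -- Greedily choose pairwise unrelated representatives: at most k classes arise.
  class-bound : ∀ xs → All V xs → AllPairs D xs → length xs ≤ k * c
  class-bound xs vs ds = greedy k [] xs [] [] ℕₚ.≤-refl vs ds (All.universal (λ _ → []) xs)

module _ {a ℓ} {A : Set a} {V : A → Set ℓ} (f : A → ℕ) (c : ℕ)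
         (fibre : ∀ v xs → All V xs → All (λ x → f x ≡ v) xs → AllPairs _≢_ xs → length xs ≤ c) where

  private
    -- The first argument is fuel, since `far` is not structurally smaller. That `ys` consists of
    -- values is encoded by transfer: any property of all `f x` holds on `ys`.
    values : ∀ n xs → length xs ≤ n → All V xs → AllPairs _≢_ xs →
      Σ (List ℕ) λ ys → AllPairs _≢_ ys × (∀ {Q : ℕ → Set} → All (Q ∘ f) xs → All Q ys) ×
        length xs ≤ c * length ys
    values _ [] _ _ _ = [] , [] , (λ _ → []) , z≤n
    values (suc n) xs′@(x ∷ xs) (s≤s le) vs ds = f x ∷ ys ,
      (keep (All.map (λ ne eq → ne (sym eq)) (Allₚ.all-filter (¬? ∘ near?) xs′)) ∷ ys! ) ,
      (λ { (q ∷ qs) → q ∷ keep (Allₚ.filter⁺ (¬? ∘ near?) (q ∷ qs)) }) , (begin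
        length xs′                   ≡⟨ length-filter-split near? xs′ ⟩
        length near + length far   ≤⟨ ℕₚ.+-mono-≤
          (fibre (f x) near (Allₚ.filter⁺ near? vs) (Allₚ.all-filter near? xs′) (AllPairsₚ.filter⁺ near? ds)) bound ⟩
        c + c * length ys        ≡⟨ ℕₚ.*-suc c (length ys) ⟨
        c * suc (length ys)        ∎)
      where
      open ℕₚ.≤-Reasoning
      near? = λ y → f y ≟ f x
      near = filter near? xs′
      far = filter (¬? ∘ near?) xs′
      far≤ : length far ≤ n
      far≤ = ℕₚ.≤-trans (ℕₚ.≤-reflexive (cong length (Listₚ.filter-reject (¬? ∘ near?) {x} {xs} λ ne → ne refl)))
        (ℕₚ.≤-trans (Listₚ.length-filter (¬? ∘ near?) xs) le)
      rec = values n far far≤ (Allₚ.filter⁺ (¬? ∘ near?) vs) (AllPairsₚ.filter⁺ (¬? ∘ near?) ds)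
      ys = proj₁ rec
      ys! = proj₁ (proj₂ rec)
      keep : ∀ {Q : ℕ → Set} → All (Q ∘ f) far → All Q ys
      keep = proj₁ (proj₂ (proj₂ rec))
      bound = proj₂ (proj₂ (proj₂ rec))

  distinct-values : ∀ xs → All V xs → AllPairs _≢_ xs →
    Σ (List ℕ) λ ys → AllPairs _≢_ ys × (∀ {Q : ℕ → Set} → All (Q ∘ f) xs → All Q ys) ×
      length xs ≤ c * length ys
  distinct-values xs = values (length xs) xs ℕₚ.≤-refl

-- Prime-power components

coprime-* : ∀ {a b m} → Coprime a m → Coprime b m → Coprime (a * b) m
coprime-* {a} {b} a⊥m b⊥m {d} (d∣ab , d∣m) =
  b⊥m (coprime-divisor {d} {a} {b} (λ (e∣d , e∣a) → a⊥m (e∣a , ℕᵈ.∣-trans e∣d d∣m)) d∣ab , d∣m)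

coprime-^ : ∀ {a m} → Coprime a m → ∀ v → Coprime (a ^ v) m
coprime-^ a⊥m zero (d∣1 , _) = ℕᵈ.∣1⇒≡1 d∣1
coprime-^ a⊥m (suc v) = coprime-* a⊥m (coprime-^ a⊥m v)

coprime-*-∣ : ∀ {a b x} → Coprime a b → a ℕᵈ.∣ x → b ℕᵈ.∣ x → a * b ℕᵈ.∣ x
coprime-*-∣ {a} {b} a⊥b (ℕᵈ.divides c refl) b∣x =
  subst (ℕᵈ._∣ c * a) (ℕₚ.*-comm b a)
    (ℕᵈ.*-monoˡ-∣ a (coprime-divisor (Coprimality.sym a⊥b) (subst (b ℕᵈ.∣_) (ℕₚ.*-comm c a) b∣x)))

prime∣prime⇒≡ : ∀ {p r} → Prime p → Prime r → p ℕᵈ.∣ r → p ≡ r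
prime∣prime⇒≡ pp pr p∣r with prime⇒irreducible pr p∣r
... | inj₁ refl = ⊥-elim (¬prime[1] pp)
... | inj₂ p≡r = p≡r

prime∣^⇒∣ : ∀ {p a} → Prime p → ∀ v → p ℕᵈ.∣ a ^ v → p ℕᵈ.∣ a
prime∣^⇒∣ pp zero d = ⊥-elim (¬prime[1] (subst Prime (ℕᵈ.∣1⇒≡1 d) pp))
prime∣^⇒∣ {a = a} pp (suc v) d with euclidsLemma a (a ^ v) pp d
... | inj₁ e = e
... | inj₂ e = prime∣^⇒∣ pp v e

prime-power-base : ∀ {p r} → Prime p → Prime r → ∀ i j → p ^ suc i ≡ r ^ j → p ≡ r
prime-power-base {p} pp pr i j eq =
  prime∣prime⇒≡ pp pr (prime∣^⇒∣ pp j (subst (p ℕᵈ.∣_) eq (ℕᵈ.m∣m*n (p ^ i))))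

1<prime : ∀ {p} → Prime p → 1 < p
1<prime pp = ℕ.nonTrivial⇒n>1 _ {{prime⇒nonTrivial pp}}

^-∣-^ : ∀ p {i j} → i ≤ j → p ^ i ℕᵈ.∣ p ^ j
^-∣-^ p {i} {j} i≤j = subst (λ t → p ^ i ℕᵈ.∣ p ^ t) (ℕₚ.m+[n∸m]≡n i≤j)
  (subst (p ^ i ℕᵈ.∣_) (sym (ℕₚ.^-distribˡ-+-* p i (j ∸ i))) (ℕᵈ.m∣m*n _))

n<a^n : ∀ {a} → 1 < a → ∀ n → n < a ^ n
n<a^n 1<a zero = ℕₚ.≤-refl
n<a^n {a} 1<a (suc n) = begin-strict
  suc n ≤⟨ n<a^n 1<a n ⟩
  a ^ n <⟨ ℕₚ.^-monoʳ-< a 1<a (ℕₚ.n<1+n n) ⟩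
  a ^ suc n ∎
  where open ℕₚ.≤-Reasoning

-- Whole components `p ^ suc v` are peeled off, with distinct primes by `¬ p ∣ m`, so that functions
-- on the factorisation recurse over components rather than over single primes.
data Factored : ℕ → Set where
  unit : Factored 1
  component : ∀ {m} p v → Prime p → ¬ p ℕᵈ.∣ m → Factored m → Factored (p ^ suc v * m)

*-left-comm : ∀ a b c → a * (b * c) ≡ b * (a * c)
*-left-comm a b c = trans (sym (ℕₚ.*-assoc a b c)) (trans (cong (_* c) (ℕₚ.*-comm a b)) (ℕₚ.*-assoc b a c))

insert : ∀ {p m} → Prime p → Factored m → Factored (p * m)
insert {p} pp unit = subst Factored (ℕₚ.*-identityʳ (p * 1))
  (component p 0 pp (λ d → ¬prime[1] (subst Prime (ℕᵈ.∣1⇒≡1 d) pp)) unit)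
insert {p} pp (component {m} r v pr r∤m F) with p ≟ r
... | yes refl = subst Factored (ℕₚ.*-assoc p (p ^ suc v) m) (component p (suc v) pp r∤m F)
... | no p≢r = subst Factored (*-left-comm (r ^ suc v) p m)
  (component r v pr (λ d → case-∣ (euclidsLemma p m pr d)) (insert pp F))
  where
  case-∣ : r ℕᵈ.∣ p ⊎ r ℕᵈ.∣ m → ⊥
  case-∣ (inj₁ r∣p) = p≢r (sym (prime∣prime⇒≡ pr pp r∣p))
  case-∣ (inj₂ r∣m) = r∤m r∣m

factored : ∀ m .{{_ : NonZero m}} → Factored m
factored m = subst Factored (sym (PrimeFactorisation.isFactorisation f))
  (from (PrimeFactorisation.factorsPrime f))
  where
  f = factorise m
  from : ∀ {ps} → All Prime ps → Factored (product ps)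
  from [] = unit
  from (pp ∷ pps) = insert pp (from pps)

-- The bounds on `p` and `v` make the property decidable by finite search.
PrimePower : ℕ → Set
PrimePower q = Σ ℕ λ p → p < suc q × (Prime p × Σ ℕ λ v → v < suc q × q ≡ p ^ suc v)

primePower? : ∀ q → Dec (PrimePower q)
primePower? q = ℕₚ.anyUpTo? (λ p → prime? p ×-dec ℕₚ.anyUpTo? (λ v → q ≟ p ^ suc v) (suc q)) (suc q)

abstract
  -- The exponential of the von Mangoldt function.
  mangoldt : ℕ → ℕ
  mangoldt q with primePower? q
  ... | yes (p , _) = p
  ... | no _ = 1

  mangoldt-cases : ∀ q → mangoldt q ≡ 1 ⊎
    Σ ℕ λ p → Σ ℕ λ v → Prime p × q ≡ p ^ suc v × mangoldt q ≡ p
  mangoldt-cases q with primePower? q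
  ... | yes (p , _ , pp , v , _ , eq) = inj₂ (p , v , pp , eq , refl)
  ... | no _ = inj₁ refl

  mangoldt-^ : ∀ {p} → Prime p → ∀ v → mangoldt (p ^ suc v) ≡ p
  mangoldt-^ {p} pp v with primePower? (p ^ suc v)
  ... | yes (r , _ , pr , j , _ , eq) = sym (prime-power-base pp pr v (suc j) eq)
  ... | no ¬pow = ⊥-elim (¬pow (p , s≤s p≤ , pp , v , s≤s (ℕₚ.<⇒≤ (ℕₚ.<-trans (ℕₚ.n<1+n v) (n<a^n (1<prime pp) (suc v)))) , refl))
    where
    p≤ : p ≤ p ^ suc v
    p≤ = ℕᵈ.∣⇒≤ {{ℕₚ.m^n≢0 p (suc v) {{prime⇒nonZero pp}}}} (ℕᵈ.m∣m*n (p ^ v))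

module _ (z : ℕ) where

  -- Every prime power `q ≤ z` dividing `m` contributes one factor of its prime, so for each prime
  -- this collects the largest power that is at most `z` and divides `m`. In this form it can be
  -- multiplied over many `m` and the products exchanged.
  smoothPart : ℕ → ℕ
  smoothPart m = ∏ z (λ i → mangoldt (suc i) ^ 𝟙 (suc i ℕᵈ.∣? m))

  private
    -- Only one prime power divides `p ^ suc v * m` but not `p ^ v * m`, namely `p ^ suc v`. If `q`
    -- is no prime power, `mangoldt q = 1` makes both sides 1.
    newPower : ∀ {p} → Prime p → ∀ v m → ¬ p ℕᵈ.∣ m → ∀ q → q ≢ p ^ suc v →
      mangoldt q ^ 𝟙 (q ℕᵈ.∣? p ^ suc v * m) ≡ mangoldt q ^ 𝟙 (q ℕᵈ.∣? p ^ v * m)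
    newPower {p} pp v m p∤m q q≢ with mangoldt-cases q
    ... | inj₁ eq = trans (cong (_^ 𝟙 (q ℕᵈ.∣? p ^ suc v * m)) eq) (trans (ℕₚ.^-zeroˡ (𝟙 (q ℕᵈ.∣? p ^ suc v * m)))
      (sym (trans (cong (_^ 𝟙 (q ℕᵈ.∣? p ^ v * m)) eq) (ℕₚ.^-zeroˡ (𝟙 (q ℕᵈ.∣? p ^ v * m))))))
    ... | inj₂ (r , j , pr , refl , _) = cong (mangoldt q ^_) (𝟙-⇔ (q ℕᵈ.∣? p ^ suc v * m) (q ℕᵈ.∣? p ^ v * m) shrink grow)
      where
      assoc : p ^ suc v * m ≡ p * (p ^ v * m)
      assoc = ℕₚ.*-assoc p (p ^ v) m
      grow : q ℕᵈ.∣ p ^ v * m → q ℕᵈ.∣ p ^ suc v * m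
      grow d = subst (q ℕᵈ.∣_) (sym assoc) (ℕᵈ.∣n⇒∣m*n p d)
      shrink : q ℕᵈ.∣ p ^ suc v * m → q ℕᵈ.∣ p ^ v * m
      shrink d with r ≟ p
      ... | no r≢p = coprime-divisor {r ^ suc j} {p}
        (coprime-^ (prime∤⇒coprime pp λ p∣r → r≢p (sym (prime∣prime⇒≡ pp pr p∣r))) (suc j))
        (subst (q ℕᵈ.∣_) assoc d)
      ... | yes refl with ℕₚ.<-cmp j v
      ... | tri< j<v _ _ = ℕᵈ.∣m⇒∣m*n m (^-∣-^ p j<v)
      ... | tri≈ _ refl _ = ⊥-elim (q≢ refl)
      ... | tri> _ _ v<j = ⊥-elim (p∤m (ℕᵈ.*-cancelˡ-∣ (p ^ suc v) {{ℕₚ.m^n≢0 p (suc v) {{prime⇒nonZero pp}}}}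
        (subst (ℕᵈ._∣ p ^ suc v * m) (ℕₚ.*-comm p (p ^ suc v)) (ℕᵈ.∣-trans (^-∣-^ p (s≤s v<j)) d))))

    predecessor : ∀ {p} → Prime p → ∀ v → Σ ℕ λ i → suc i ≡ p ^ v
    predecessor {p} pp v = ℕ.pred (p ^ v) , ℕₚ.suc-pred (p ^ v) {{ℕₚ.m^n≢0 p v {{prime⇒nonZero pp}}}}

  smoothPart-step-≤ : ∀ {p} → Prime p → ∀ v m → ¬ p ℕᵈ.∣ m → p ^ suc v ≤ z →
    smoothPart (p ^ suc v * m) ≡ p * smoothPart (p ^ v * m)
  smoothPart-step-≤ {p} pp v m p∤m le with predecessor pp (suc v)
  ... | i , eq = ∏-update z i p
    (λ j j≢i → newPower pp v m p∤m (suc j) (λ eq′ → j≢i (ℕₚ.suc-injective (trans eq′ (sym eq)))))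
    at (subst (_≤ z) (sym eq) le)
    where
    open ≡-Reasoning
    q = p ^ suc v
    q∤ : ¬ q ℕᵈ.∣ p ^ v * m
    q∤ d = p∤m (ℕᵈ.*-cancelˡ-∣ (p ^ v) {{ℕₚ.m^n≢0 p v {{prime⇒nonZero pp}}}}
      (subst (ℕᵈ._∣ p ^ v * m) (ℕₚ.*-comm p (p ^ v)) d))
    at : mangoldt (suc i) ^ 𝟙 (suc i ℕᵈ.∣? q * m) ≡ p * mangoldt (suc i) ^ 𝟙 (suc i ℕᵈ.∣? p ^ v * m)
    at = begin
      mangoldt (suc i) ^ 𝟙 (suc i ℕᵈ.∣? q * m)
        ≡⟨ cong (mangoldt (suc i) ^_) (𝟙-yes (suc i ℕᵈ.∣? q * m) (subst (ℕᵈ._∣ q * m) (sym eq) (ℕᵈ.m∣m*n m))) ⟩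
      mangoldt (suc i) * 1
        ≡⟨ cong (_* 1) (trans (cong mangoldt eq) (mangoldt-^ pp v)) ⟩
      p * 1
        ≡⟨ cong (λ e → p * mangoldt (suc i) ^ e) (𝟙-no (suc i ℕᵈ.∣? p ^ v * m) (q∤ ∘ subst (ℕᵈ._∣ p ^ v * m) eq)) ⟨
      p * mangoldt (suc i) ^ 𝟙 (suc i ℕᵈ.∣? p ^ v * m) ∎

  smoothPart-step-> : ∀ {p} → Prime p → ∀ v m → ¬ p ℕᵈ.∣ m → z < p ^ suc v →
    smoothPart (p ^ suc v * m) ≡ smoothPart (p ^ v * m)
  smoothPart-step-> {p} pp v m p∤m lt with predecessor pp (suc v)
  ... | i , eq = ∏-update-out z i
    (λ j j≢i → newPower pp v m p∤m (suc j) (λ eq′ → j≢i (ℕₚ.suc-injective (trans eq′ (sym eq)))))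
    (ℕₚ.≤-pred (subst (z <_) (sym eq) lt))

  smoothPart-^-≤z : ∀ {p} → Prime p → ∀ v m → ¬ p ℕᵈ.∣ m → p ^ v ≤ z →
    smoothPart (p ^ v * m) ≡ p ^ v * smoothPart m
  smoothPart-^-≤z {p} pp zero m p∤m le =
    trans (cong smoothPart (ℕₚ.*-identityˡ m)) (sym (ℕₚ.*-identityˡ (smoothPart m)))
  smoothPart-^-≤z {p} pp (suc v) m p∤m le = begin
    smoothPart (p ^ suc v * m)       ≡⟨ smoothPart-step-≤ pp v m p∤m le ⟩
    p * smoothPart (p ^ v * m)     ≡⟨ cong (p *_) (smoothPart-^-≤z pp v m p∤m
      (ℕₚ.≤-trans (ℕᵈ.∣⇒≤ {{ℕₚ.m^n≢0 p (suc v) {{prime⇒nonZero pp}}}} (ℕᵈ.n∣m*n p)) le)) ⟩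
    p * (p ^ v * smoothPart m)     ≡⟨ ℕₚ.*-assoc p (p ^ v) (smoothPart m) ⟨
    p ^ suc v * smoothPart m         ∎
    where open ≡-Reasoning

  smoothPart-^-≤ : ∀ {p} → Prime p → ∀ v m → ¬ p ℕᵈ.∣ m →
    smoothPart (p ^ v * m) ≤ p ^ v * smoothPart m
  smoothPart-^-≤ {p} pp zero m p∤m =
    ℕₚ.≤-reflexive (trans (cong smoothPart (ℕₚ.*-identityˡ m)) (sym (ℕₚ.*-identityˡ (smoothPart m))))
  smoothPart-^-≤ {p} pp (suc v) m p∤m with p ^ suc v ≤? z
  ... | yes le = ℕₚ.≤-reflexive (smoothPart-^-≤z pp (suc v) m p∤m le)
  ... | no nle = ℕₚ.≤-trans (ℕₚ.≤-reflexive (smoothPart-step-> pp v m p∤m (ℕₚ.≰⇒> nle)))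
    (ℕₚ.≤-trans (smoothPart-^-≤ pp v m p∤m) (ℕₚ.*-monoˡ-≤ (smoothPart m)
      (ℕᵈ.∣⇒≤ {{ℕₚ.m^n≢0 p (suc v) {{prime⇒nonZero pp}}}} (ℕᵈ.n∣m*n p))))

  smoothPart-^-≥ : ∀ {p} → Prime p → ∀ v m → ¬ p ℕᵈ.∣ m → smoothPart m ≤ smoothPart (p ^ v * m)
  smoothPart-^-≥ {p} pp zero m p∤m = ℕₚ.≤-reflexive (cong smoothPart (sym (ℕₚ.*-identityˡ m)))
  smoothPart-^-≥ {p} pp (suc v) m p∤m with p ^ suc v ≤? z
  ... | yes le = ℕₚ.≤-trans (smoothPart-^-≥ pp v m p∤m)
    (ℕₚ.≤-trans (ℕₚ.m≤n*m _ p {{prime⇒nonZero pp}}) (ℕₚ.≤-reflexive (sym (smoothPart-step-≤ pp v m p∤m le))))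
  ... | no nle = ℕₚ.≤-trans (smoothPart-^-≥ pp v m p∤m)
    (ℕₚ.≤-reflexive (sym (smoothPart-step-> pp v m p∤m (ℕₚ.≰⇒> nle))))

  smoothPart-1 : smoothPart 1 ≡ 1
  smoothPart-1 = trans (∏-cong z λ i _ → term i) (trans (∏-const z 1) (ℕₚ.^-zeroˡ z))
    where
    term : ∀ i → mangoldt (suc i) ^ 𝟙 (suc i ℕᵈ.∣? 1) ≡ 1
    term i with mangoldt-cases (suc i)
    ... | inj₁ eq = trans (cong (_^ 𝟙 (suc i ℕᵈ.∣? 1)) eq) (ℕₚ.^-zeroˡ (𝟙 (suc i ℕᵈ.∣? 1)))
    ... | inj₂ (p , v , pp , eq , _) = cong (mangoldt (suc i) ^_) (𝟙-no (suc i ℕᵈ.∣? 1) λ d →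
      ¬prime[1] (subst Prime (ℕᵈ.∣1⇒≡1 (ℕᵈ.∣-trans (subst (p ℕᵈ.∣_) (sym eq) (ℕᵈ.m∣m*n (p ^ v))) d)) pp))

  smoothPart≤ : ∀ {m} → Factored m → smoothPart m ≤ m
  smoothPart≤ unit = ℕₚ.≤-reflexive smoothPart-1
  smoothPart≤ (component {m} p v pp p∤m F) =
    ℕₚ.≤-trans (smoothPart-^-≤ pp (suc v) m p∤m) (ℕₚ.*-monoʳ-≤ (p ^ suc v) (smoothPart≤ F))

  small : ∀ {m} → Factored m → ℕ
  small unit = 1
  small (component p v _ _ F) with p ^ suc v ≤? z
  ... | yes _ = p ^ suc v * small F
  ... | no _ = small F

  large : ∀ {m} → Factored m → ℕ
  large unit = 1
  large (component p v _ _ F) with p ^ suc v ≤? z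
  ... | yes _ = large F
  ... | no _ = p ^ suc v * large F

  #large : ∀ {m} → Factored m → ℕ
  #large unit = 0
  #large (component p v _ _ F) with p ^ suc v ≤? z
  ... | yes _ = #large F
  ... | no _ = suc (#large F)

  -- Stated component by component, so that `fibre-bound` can treat one modulus at a time; `large∣`
  -- recovers divisibility by the product.
  LargeDivide : ∀ {m} → Factored m → ℕ → Set
  LargeDivide unit d = ⊤
  LargeDivide (component p v _ _ F) d with p ^ suc v ≤? z
  ... | yes _ = LargeDivide F d
  ... | no _ = p ^ suc v ℕᵈ.∣ d × LargeDivide F d

  small≤smoothPart : ∀ {m} (F : Factored m) → small F ≤ smoothPart m
  small≤smoothPart unit = ℕₚ.≤-reflexive (sym smoothPart-1)
  small≤smoothPart (component {m} p v pp p∤m F) with p ^ suc v ≤? z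
  ... | yes le = ℕₚ.≤-trans (ℕₚ.*-monoʳ-≤ (p ^ suc v) (small≤smoothPart F))
    (ℕₚ.≤-reflexive (sym (smoothPart-^-≤z pp (suc v) m p∤m le)))
  ... | no _ = ℕₚ.≤-trans (small≤smoothPart F) (smoothPart-^-≥ pp (suc v) m p∤m)

  small*large : ∀ {m} (F : Factored m) → small F * large F ≡ m
  small*large unit = refl
  small*large (component {m} p v pp p∤m F) with p ^ suc v ≤? z
  ... | yes _ = trans (ℕₚ.*-assoc (p ^ suc v) _ _) (cong (p ^ suc v *_) (small*large F))
  ... | no _ = trans (*-left-comm (small F) (p ^ suc v) _) (cong (p ^ suc v *_) (small*large F))

  z^#large≤large : ∀ {m} (F : Factored m) → z ^ #large F ≤ large F
  z^#large≤large unit = ℕₚ.≤-refl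
  z^#large≤large (component p v pp p∤m F) with p ^ suc v ≤? z
  ... | yes _ = z^#large≤large F
  ... | no nle = ℕₚ.*-mono-≤ (ℕₚ.<⇒≤ (ℕₚ.≰⇒> nle)) (z^#large≤large F)

  large∣ : ∀ {m} (F : Factored m) d → LargeDivide F d → large F ℕᵈ.∣ d
  large∣ unit d _ = ℕᵈ.1∣ d
  large∣ (component {m} p v pp p∤m F) d ds with p ^ suc v ≤? z
  ... | yes _ = large∣ F d ds
  ... | no _ = coprime-*-∣ (coprime-^ p⊥large (suc v)) (proj₁ ds) (large∣ F d (proj₂ ds))
    where
    large∣m : large F ℕᵈ.∣ m
    large∣m = ℕᵈ.divides (small F) (sym (small*large F))
    p⊥large : Coprime p (large F)
    p⊥large = Coprimality.sym (prime∤⇒coprime pp λ p∣l → p∤m (ℕᵈ.∣-trans p∣l large∣m))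

-- Values on the box of pairs (A, b)

lucasℕ-pos : ∀ {A} b j → 1 ≤ A → 1 ≤ lucasℕ A b (suc j)
lucasℕ-pos b zero 1≤A = ℕₚ.≤-refl
lucasℕ-pos b (suc j) 1≤A = ℕₚ.≤-trans (ℕₚ.*-mono-≤ 1≤A (lucasℕ-pos b j 1≤A)) (ℕₚ.m≤m+n _ _)

lucasℕ-mono : ∀ {A A′ b b′} j → A ≤ A′ → b ≤ b′ → lucasℕ A b j ≤ lucasℕ A′ b′ j
lucasℕ-mono 0 le le′ = z≤n
lucasℕ-mono 1 le le′ = ℕₚ.≤-refl
lucasℕ-mono (suc (suc j)) le le′ =
  ℕₚ.+-mono-≤ (ℕₚ.*-mono-≤ le (lucasℕ-mono (suc j) le le′)) (ℕₚ.*-mono-≤ le′ (lucasℕ-mono j le le′))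

lucasℕ-strict : ∀ {A A′ b b′} j → 1 ≤ A → A ≤ A′ → b < b′ →
  lucasℕ A b (suc (suc (suc j))) < lucasℕ A′ b′ (suc (suc (suc j)))
lucasℕ-strict {A} {A′} {b} {b′} j 1≤A le lt = begin-strict
  A * lucasℕ A b (suc (suc j)) + b * lucasℕ A b (suc j)
    <⟨ ℕₚ.+-monoʳ-< _ (ℕₚ.*-monoˡ-< (lucasℕ A b (suc j)) {{>-nonZero (lucasℕ-pos b j 1≤A)}} lt) ⟩
  A * lucasℕ A b (suc (suc j)) + b′ * lucasℕ A b (suc j)
    ≤⟨ ℕₚ.+-mono-≤ (ℕₚ.*-mono-≤ le (lucasℕ-mono (suc (suc j)) le (ℕₚ.<⇒≤ lt)))
                   (ℕₚ.*-monoʳ-≤ b′ (lucasℕ-mono (suc j) le (ℕₚ.<⇒≤ lt))) ⟩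
  A′ * lucasℕ A′ b′ (suc (suc j)) + b′ * lucasℕ A′ b′ (suc j) ∎
  where open ℕₚ.≤-Reasoning

b^k≤lucasℕ : ∀ A b k → b ^ k ≤ lucasℕ A b (odd k)
b^k≤lucasℕ A b zero = ℕₚ.≤-refl
b^k≤lucasℕ A b (suc k) = ℕₚ.≤-trans (ℕₚ.*-monoʳ-≤ b (b^k≤lucasℕ A b k)) (ℕₚ.m≤n+m _ _)

-- The weights again: `A ≤ Y` and `b ≤ Y²` make every monomial at most `Y ^ j`, and the factor
-- `2 ^ j` covers their number.
lucasℕ≤ : ∀ {A b} Y j → A ≤ Y → b ≤ Y * Y → lucasℕ A b (suc j) ≤ (2 * Y) ^ j
lucasℕ≤ Y zero A≤ b≤ = ℕₚ.≤-refl
lucasℕ≤ {A} {b} Y 1 A≤ b≤ = begin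
  A * 1 + b * 0 ≡⟨ cong₂ _+_ (ℕₚ.*-identityʳ A) (ℕₚ.*-zeroʳ b) ⟩
  A + 0             ≡⟨ ℕₚ.+-identityʳ A ⟩
  A                   ≤⟨ A≤ ⟩
  Y                   ≤⟨ ℕₚ.m≤n*m Y 2 ⟩
  2 * Y             ≡⟨ ℕₚ.*-identityʳ _ ⟨
  2 * Y * 1       ∎
  where open ℕₚ.≤-Reasoning
lucasℕ≤ {A} {b} Y (suc (suc j)) A≤ b≤ = begin
  A * lucasℕ A b (suc (suc j)) + b * lucasℕ A b (suc j)
    ≤⟨ ℕₚ.+-mono-≤ (ℕₚ.*-mono-≤ A≤ (lucasℕ≤ Y (suc j) A≤ b≤)) (ℕₚ.*-mono-≤ b≤ (lucasℕ≤ Y j A≤ b≤)) ⟩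
  Y * (2 * Y * w) + Y * Y * w
    ≤⟨ ℕₚ.+-monoʳ-≤ _ (ℕₚ.m≤n*m (Y * Y * w) 2) ⟩
  Y * (2 * Y * w) + 2 * (Y * Y * w)
    ≡⟨ collect Y w ⟩
  2 * Y * (2 * Y * w) ∎
  where
  open ℕₚ.≤-Reasoning
  w = (2 * Y) ^ j
  collect : ∀ Y w → Y * (2 * Y * w) + 2 * (Y * Y * w) ≡ 2 * Y * (2 * Y * w)
  collect = ℕSolver.solve-∀

∤⇒primitiveRoot : ∀ {p A b} → Prime p → Coprime A b → ∀ v k → p ^ v ℕᵈ.∣ lucasℕ A b (odd k) →
  PrimitiveRoot p v k (A , b)
∤⇒primitiveRoot {p} {A} {b} pp A⊥b v k d =
  subst (+ (p ^ v) ∣ᶻ_) (sym (lucas-+ A b (odd k))) (∣ᵤ⇒∣ d) ,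
  λ (p∣A , p∣b) → ¬prime[1] (subst Prime (A⊥b (∣⇒∣ᵤ p∣A , ∣⇒∣ᵤ p∣b)) pp)

-- Since A ≡ 0 and b ≡ 1 modulo M, no prime factor of a value divides M, hence none divides n.
module Family (k M : ℕ) (odd∣M : odd k ℕᵈ.∣ M) where

  Aᵢ bⱼ : ℕ → ℕ
  Aᵢ i = M * suc i
  bⱼ j = suc (M * j)

  value : ℕ → ℕ → ℕ
  value i j = lucasℕ (Aᵢ i) (bⱼ j) (odd k)

  ∣bⱼ⇒∤M : ∀ {g j} → g ℕᵈ.∣ bⱼ j → g ℕᵈ.∣ M → g ≡ 1
  ∣bⱼ⇒∤M {g} {j} g∣b g∣M = ℕᵈ.∣1⇒≡1
    (ℕᵈ.∣m+n∣m⇒∣n (subst (g ℕᵈ.∣_) (ℕₚ.+-comm 1 (M * j)) g∣b) (ℕᵈ.∣m⇒∣m*n j g∣M))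

  module _ {p : ℕ} (pp : Prime p) (v i : ℕ) where

    private q = p ^ suc v

    RootAt : ℕ → Set
    RootAt j = Coprime (Aᵢ i) (bⱼ j) × q ℕᵈ.∣ value i j

    rootAt⇒primitiveRoot : ∀ j → RootAt j → PrimitiveRoot p (suc v) k (Aᵢ i , bⱼ j)
    rootAt⇒primitiveRoot j (A⊥b , d) = ∤⇒primitiveRoot pp A⊥b (suc v) k d

    rootAt⇒∤M : ∀ j → RootAt j → ¬ + p ∣ᶻ + M
    rootAt⇒∤M j r p∣M = root⇒∤A pp v k (Aᵢ i) (bⱼ j) (rootAt⇒primitiveRoot j r)
      (subst (+ p ∣ᶻ_) (sym (ℤₚ.pos-* M (suc i))) (∣m⇒∣m*n (+ suc i) p∣M))

    rootAt⇒∤odd : ∀ j → RootAt j → ¬ + p ∣ᶻ + odd k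
    rootAt⇒∤odd j r d = rootAt⇒∤M j r (∣ᵤ⇒∣ (ℕᵈ.∣-trans (∣⇒∣ᵤ d) odd∣M))

    -- By `Δ-progression`, `Δ` is up to sign `(j ∸ j′) A² M`. Here `A` and `M` are units modulo `p`,
    -- and `0 < j ∸ j′ < q`.
    roots-apart : ∀ c {j j′} → RootAt (c + j) → RootAt (c + j′) → j′ < j × j < q →
      ¬ + q ∣ᶻ Δ (Aᵢ i , bⱼ (c + j)) (Aᵢ i , bⱼ (c + j′))
    roots-apart c {j} {j′} r r′ (j′<j , j<q) d = ℕₚ.<⇒≱ (ℕₚ.≤-<-trans (ℕₚ.m∸n≤m j j′) j<q)
      (ℕᵈ.∣⇒≤ {{>-nonZero (ℕₚ.m<n⇒0<n∸m j′<j)}} (∣⇒∣ᵤ q∣e))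
      where
      A = Aᵢ i
      e = j ∸ j′
      ∤A = root⇒∤A pp v k A (bⱼ (c + j)) (rootAt⇒primitiveRoot (c + j) r)
      c+j : c + j ≡ c + j′ + e
      c+j = trans (cong (λ t → c + t) (sym (ℕₚ.m+[n∸m]≡n (ℕₚ.<⇒≤ j′<j)))) (sym (ℕₚ.+-assoc c j′ e))
      q∣e : + q ∣ᶻ + e
      q∣e = prime-power-cancel pp (suc v) (+ e) (+ A ℤ.* + A ℤ.* + M)
        (subst (+ q ∣ᶻ_) (trans (cong (λ t → - Δ (A , bⱼ t) (A , bⱼ (c + j′))) c+j) (Δ-progression A M (c + j′) e))
          (∣m⇒∣-m d))
        (∤-* pp (∤-* pp ∤A ∤A) (rootAt⇒∤M (c + j) r))

    rootAt? : ∀ j → Dec (RootAt j)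
    rootAt? j = coprime? (Aᵢ i) (bⱼ j) ×-dec (q ℕᵈ.∣? value i j)

    roots-in-window : ∀ c → ∑ q (λ j → 𝟙 (rootAt? (c + j))) ≤ k
    roots-in-window c = count-bound q k (λ j → rootAt? (c + j)) bound
      where
      pair : ℕ → ℕ × ℕ
      pair j = Aᵢ i , bⱼ (c + j)
      bound : ∀ xs → All (RootAt ∘ (λ t → c + t)) xs → AllPairs (λ j j′ → j′ < j × j < q) xs → length xs ≤ k
      bound [] _ _ = z≤n
      bound xs@(x ∷ _) rs@(r ∷ _) lts = subst (_≤ k) (Listₚ.length-map pair xs)
        (roots-bounded pp v k (rootAt⇒∤odd (c + x) r) (map pair xs)
          (Allₚ.map⁺ (All.map (λ {j} → rootAt⇒primitiveRoot (c + j)) rs))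
          (AllPairsₚ.map⁺ (AllPairs-map-All (roots-apart c) rs lts)))

    -- Covering by windows needs `z / q + 1` of them, at most twice `z / q` since `q ≤ z`. The bound
    -- counts multiples of `q` in order to be compared with the factorisations of `1, ..., z`.
    roots-in-interval : ∀ z c → q ≤ z →
      ∑ z (λ j → 𝟙 (rootAt? (c + j))) ≤ count z (λ x → q ℕᵈ.∣? suc x) * (2 * k)
    roots-in-interval z c q≤z = begin
      ∑ z (λ j → 𝟙 (rootAt? (c + j)))  ≤⟨ windows-/ (𝟙 ∘ rootAt?) q k roots-in-window z c ⟩
      suc t * k                        ≤⟨ ℕₚ.*-monoˡ-≤ k (ℕₚ.+-monoˡ-≤ t (m≥n⇒m/n>0 q≤z)) ⟩
      (t + t) * k                    ≡⟨ double-* t k ⟩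
      t * (2 * k)                    ≤⟨ ℕₚ.*-monoˡ-≤ (2 * k) (ℕₚ.≤-trans (multiples q t) (∑-monoˡ _ (m/n*n≤m z q))) ⟩
      count z (λ x → q ℕᵈ.∣? suc x) * (2 * k) ∎
      where
      open ℕₚ.≤-Reasoning
      instance q≢0 = ℕₚ.m^n≢0 p (suc v) {{prime⇒nonZero pp}}
      t = z / q
      double-* : ∀ t k → (t + t) * k ≡ t * (2 * k)
      double-* = ℕSolver.solve-∀

  module _ (z i : ℕ) where

    -- Equal to 1 when the pair is not coprime, so products may run over all `j` although the root
    -- counts hold for coprime pairs.
    coprimeSmoothPart : ℕ → ℕ
    coprimeSmoothPart j =
      ∏ z (λ x → mangoldt (suc x) ^ 𝟙 (coprime? (Aᵢ i) (bⱼ j) ×-dec suc x ℕᵈ.∣? value i j))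

    smoothPart≤coprimeSmoothPart : ∀ j → Coprime (Aᵢ i) (bⱼ j) → smoothPart z (value i j) ≤ coprimeSmoothPart j
    smoothPart≤coprimeSmoothPart j A⊥b = ℕₚ.≤-reflexive (∏-cong z λ x _ → cong (mangoldt (suc x) ^_)
      (𝟙-⇔ (suc x ℕᵈ.∣? value i j) (coprime? (Aᵢ i) (bⱼ j) ×-dec suc x ℕᵈ.∣? value i j) (λ d → A⊥b , d) proj₂))

    1≤mangoldt : ∀ q → 1 ≤ mangoldt q
    1≤mangoldt q with mangoldt-cases q
    ... | inj₁ eq = ℕₚ.≤-reflexive (sym eq)
    ... | inj₂ (p , _ , pp , _ , eq) = subst (1 ≤_) (sym eq) (ℕₚ.<⇒≤ (1<prime pp))

    1≤coprimeSmoothPart : ∀ j → 1 ≤ coprimeSmoothPart j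
    1≤coprimeSmoothPart j = ℕₚ.≤-trans (ℕₚ.≤-reflexive (sym (trans (∏-const z 1) (ℕₚ.^-zeroˡ z))))
      (∏-mono z λ x _ → ℕₚ.m^n>0 (mangoldt (suc x)) {{>-nonZero (1≤mangoldt (suc x))}}
        (𝟙 (coprime? (Aᵢ i) (bⱼ j) ×-dec suc x ℕᵈ.∣? value i j)))

    private
      exponent-≤ : ∀ c x → x < z →
        ∏ z (λ j → mangoldt (suc x) ^ 𝟙 (coprime? (Aᵢ i) (bⱼ (c + j)) ×-dec suc x ℕᵈ.∣? value i (c + j)))
        ≤ ∏ z (λ y → mangoldt (suc x) ^ 𝟙 (suc x ℕᵈ.∣? suc y)) ^ (2 * k)
      exponent-≤ c x x<z = begin
        ∏ z (λ j → w ^ 𝟙 (coprime? (Aᵢ i) (bⱼ (c + j)) ×-dec suc x ℕᵈ.∣? value i (c + j)))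
          ≡⟨ ∏-^-∑ z w _ ⟩
        w ^ roots (suc x)
          ≤⟨ compare (mangoldt-cases (suc x)) ⟩
        w ^ (mults (suc x) * (2 * k))
          ≡⟨ ℕₚ.^-*-assoc w (mults (suc x)) (2 * k) ⟨
        (w ^ mults (suc x)) ^ (2 * k)
          ≡⟨ cong (_^ (2 * k)) (∏-^-∑ z w _) ⟨
        ∏ z (λ y → w ^ 𝟙 (suc x ℕᵈ.∣? suc y)) ^ (2 * k) ∎
        where
        open ℕₚ.≤-Reasoning
        w = mangoldt (suc x)
        roots mults : ℕ → ℕ
        roots q = ∑ z (λ j → 𝟙 (coprime? (Aᵢ i) (bⱼ (c + j)) ×-dec q ℕᵈ.∣? value i (c + j)))
        mults q = count z (λ y → q ℕᵈ.∣? suc y)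
        compare : w ≡ 1 ⊎ (Σ ℕ λ p → Σ ℕ λ v → Prime p × suc x ≡ p ^ suc v × w ≡ p) →
          w ^ roots (suc x) ≤ w ^ (mults (suc x) * (2 * k))
        compare (inj₁ w≡1) = ℕₚ.≤-reflexive (trans (1^ (roots (suc x))) (sym (1^ (mults (suc x) * (2 * k)))))
          where
          1^ : ∀ n → w ^ n ≡ 1
          1^ n = trans (cong (_^ n) w≡1) (ℕₚ.^-zeroˡ n)
        compare (inj₂ (p , v , pp , q≡ , _)) = ℕₚ.^-monoʳ-≤ w {{>-nonZero (1≤mangoldt (suc x))}}
          (subst (λ q → q ≤ z → roots q ≤ mults q * (2 * k)) (sym q≡) (roots-in-interval pp v i z c) x<z)

    -- Comparison with z! = ∏_{x ≤ z} ∏_{q ∣ x} mangoldt q.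
    coprimeSmoothPart-block : ∀ c → ∏ z (λ j → coprimeSmoothPart (c + j)) ≤ (z ^ z) ^ (2 * k)
    coprimeSmoothPart-block c = begin
      ∏ z (λ j → coprimeSmoothPart (c + j))
        ≡⟨ ∏-swap z z _ ⟩
      ∏ z (λ x → ∏ z (λ j → mangoldt (suc x) ^ 𝟙 (coprime? (Aᵢ i) (bⱼ (c + j)) ×-dec suc x ℕᵈ.∣? value i (c + j))))
        ≤⟨ ∏-mono z (exponent-≤ c) ⟩
      ∏ z (λ x → ∏ z (λ y → mangoldt (suc x) ^ 𝟙 (suc x ℕᵈ.∣? suc y)) ^ (2 * k))
        ≡⟨ ∏-^ z (2 * k) _ ⟩
      ∏ z (λ x → ∏ z (λ y → mangoldt (suc x) ^ 𝟙 (suc x ℕᵈ.∣? suc y))) ^ (2 * k)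
        -- After the exchange the inner product is by definition the smooth part of `suc y`, hence
        -- at most `suc y ≤ z`.
        ≡⟨ cong (_^ (2 * k)) (∏-swap z z _) ⟩
      ∏ z (λ y → smoothPart z (suc y)) ^ (2 * k)
        ≤⟨ ℕₚ.^-monoˡ-≤ (2 * k) (∏-mono z λ y y<z → ℕₚ.≤-trans (smoothPart≤ z (factored (suc y))) y<z) ⟩
      ∏ z (λ _ → z) ^ (2 * k)
        ≡⟨ cong (_^ (2 * k)) (∏-const z z) ⟩
      (z ^ z) ^ (2 * k) ∎
      where open ℕₚ.≤-Reasoning

    -- Markov's inequality in multiplicative form.
    rough-mostly : 1 ≤ k → 2 ≤ z → ∀ t c →
      4 * count (t * z) (λ j → coprime? (Aᵢ i) (bⱼ (c + j)) ×-dec (z ^ (8 * k) <? smoothPart z (value i (c + j))))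
      ≤ t * z
    -- Exponents of `z` are compared: a bad `j` contributes at least `8k`, while the total over
    -- `t * z` indices is at most `2k` on average. The ratio 4 of these exponents is the 4 of the
    -- statement.
    rough-mostly 1≤k 2≤z t c = ℕₚ.*-cancelˡ-≤ (2 * k) {{ℕₚ.m*n≢0 2 k {{_}} {{>-nonZero 1≤k}}}}
      (subst₂ _≤_ (regroup k X) (regroup′ z k t) (ℕₚ.≮⇒≥ λ lt → ℕₚ.<⇒≱ (ℕₚ.^-monoʳ-< z 2≤z lt) powers))
      where
      open ℕₚ.≤-Reasoning
      bad? = λ j → coprime? (Aᵢ i) (bⱼ (c + j)) ×-dec (z ^ (8 * k) <? smoothPart z (value i (c + j)))
      X = count (t * z) bad?
      regroup : ∀ k X → 8 * k * X ≡ 2 * k * (4 * X)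
      regroup = ℕSolver.solve-∀
      regroup′ : ∀ z k t → z * (2 * k) * t ≡ 2 * k * (t * z)
      regroup′ = ℕSolver.solve-∀
      markov : ∀ j → (z ^ (8 * k)) ^ 𝟙 (bad? j) ≤ coprimeSmoothPart (c + j)
      markov j with bad? j
      ... | yes (A⊥b , lt) = ℕₚ.≤-trans (ℕₚ.≤-reflexive (ℕₚ.*-identityʳ _))
        (ℕₚ.≤-trans (ℕₚ.<⇒≤ lt) (smoothPart≤coprimeSmoothPart (c + j) A⊥b))
      ... | no _ = 1≤coprimeSmoothPart (c + j)
      powers : z ^ (8 * k * X) ≤ z ^ (z * (2 * k) * t)
      powers = begin
        z ^ (8 * k * X)                                   ≡⟨ ℕₚ.^-*-assoc z (8 * k) X ⟨
        (z ^ (8 * k)) ^ X                                 ≡⟨ ∏-^-∑ (t * z) (z ^ (8 * k)) _ ⟨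
        ∏ (t * z) (λ j → (z ^ (8 * k)) ^ 𝟙 (bad? j))    ≤⟨ ∏-mono (t * z) (λ j _ → markov j) ⟩
        ∏ (t * z) (λ j → coprimeSmoothPart (c + j))         ≤⟨ ∏-windows coprimeSmoothPart z _ coprimeSmoothPart-block t c ⟩
        ((z ^ z) ^ (2 * k)) ^ t                         ≡⟨ cong (_^ t) (ℕₚ.^-*-assoc z z (2 * k)) ⟩
        (z ^ (z * (2 * k))) ^ t                         ≡⟨ ℕₚ.^-*-assoc z (z * (2 * k)) t ⟩
        z ^ (z * (2 * k) * t)                           ∎

-- Sparse multiples and pairs with a common factor.

module _ (f : ℕ → ℕ) (g : ℕ) .{{_ : NonZero g}}
         (apart : ∀ c {i j} → j < i → i < g → g ℕᵈ.∣ f (c + i) → g ℕᵈ.∣ f (c + j) → ⊥) where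

  sparse-count : ∀ n c → g * count n (λ i → g ℕᵈ.∣? f (c + i)) ≤ g + n
  sparse-count n c = begin
    g * count n (λ i → g ℕᵈ.∣? f (c + i)) ≤⟨ ℕₚ.*-monoʳ-≤ g (windows-/ (λ i → 𝟙 (g ℕᵈ.∣? f i)) g 1 window n c) ⟩
    g * (suc (n / g) * 1)                 ≡⟨ regroup g (n / g) ⟩
    g + n / g * g                         ≤⟨ ℕₚ.+-monoʳ-≤ g (m/n*n≤m n g) ⟩
    g + n                                   ∎
    where
    open ℕₚ.≤-Reasoning
    regroup : ∀ g t → g * (suc t * 1) ≡ g + t * g
    regroup = ℕSolver.solve-∀
    window : ∀ c → ∑ g (λ i → 𝟙 (g ℕᵈ.∣? f (c + i))) ≤ 1
    window c = count-bound g 1 (λ i → g ℕᵈ.∣? f (c + i)) λ where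
      [] _ _ → z≤n
      (_ ∷ []) _ _ → ℕₚ.≤-refl
      (i ∷ j ∷ _) (d ∷ d′ ∷ _) (((j<i , i<g) ∷ _) ∷ _) → ⊥-elim (apart c j<i i<g d d′)

∣offsets⇒⊥ : ∀ {g i j} → j < i → i < g → g ℕᵈ.∣ i ∸ j → ⊥
∣offsets⇒⊥ {g} {i} {j} j<i i<g d =
  ℕₚ.<⇒≱ (ℕₚ.≤-<-trans (ℕₚ.m∸n≤m i j) i<g) (ℕᵈ.∣⇒≤ {{>-nonZero (ℕₚ.m<n⇒0<n∸m j<i)}} d)

-- ∑ 1/g² over g > c telescopes below 1/c.
∑-inverse-squares : ∀ c .{{_ : NonZero c}} Y (X : ℕ → ℕ) → (∀ t → suc (c + t) * suc (c + t) * X t ≤ Y) →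
  ∀ n → c * ∑ n X ≤ Y
∑-inverse-squares c@(suc c′) Y X le n =
  ℕₚ.*-cancelʳ-≤ _ _ (c + n) (ℕₚ.≤-trans (ind n) (ℕₚ.*-monoʳ-≤ Y (ℕₚ.m≤n+m n c)))
  where
  open ℕₚ.≤-Reasoning
  expand : ∀ c s x h → c * (s + x) * suc h * h + c * (suc h * x) ≡
    (c * s * h) * suc h + c * (suc h * suc h * x)
  expand = ℕSolver.solve-∀
  factor : ∀ c Y t → Y * t * suc (c + t) + c * Y ≡ Y * suc t * (c + t)
  factor = ℕSolver.solve-∀
  -- Denominators cleared, this bounds the partial sum by `Y (1/c - 1/(c + t)) = Y t / (c (c + t))`;
  -- the step uses `1/(h + 1)² ≤ 1/(h (h + 1))`.
  ind : ∀ t → c * ∑ t X * (c + t) ≤ Y * t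
  ind zero = ℕₚ.≤-reflexive (trans (cong (_* (c + 0)) (ℕₚ.*-zeroʳ c)) (sym (ℕₚ.*-zeroʳ Y)))
  ind (suc t) = ℕₚ.*-cancelʳ-≤ _ _ (c + t) (begin
    c * (∑ t X + X t) * (c + suc t) * (c + t)
      ≡⟨ cong (λ s → c * (∑ t X + X t) * s * (c + t)) (ℕₚ.+-suc c t) ⟩
    c * (∑ t X + X t) * suc (c + t) * (c + t)
      ≤⟨ ℕₚ.m≤m+n _ (c * (suc (c + t) * X t)) ⟩
    c * (∑ t X + X t) * suc (c + t) * (c + t) + c * (suc (c + t) * X t)
      ≡⟨ expand c (∑ t X) (X t) (c + t) ⟩
    (c * ∑ t X * (c + t)) * suc (c + t) + c * (suc (c + t) * suc (c + t) * X t)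
      ≤⟨ ℕₚ.+-mono-≤ (ℕₚ.*-monoˡ-≤ (suc (c + t)) (ind t)) (ℕₚ.*-monoʳ-≤ c (le t)) ⟩
    Y * t * suc (c + t) + c * Y
      ≡⟨ factor c Y t ⟩
    Y * suc t * (c + t) ∎)

module _ (k M : ℕ) (odd∣M : odd k ℕᵈ.∣ M) where

  open Family k M odd∣M

  ∣bⱼ⇒coprimeM : ∀ {g j} → g ℕᵈ.∣ bⱼ j → Coprime g M
  ∣bⱼ⇒coprimeM {g} {j} g∣b {d} (d∣g , d∣M) = ∣bⱼ⇒∤M {d} {j} (ℕᵈ.∣-trans d∣g g∣b) d∣M

  module _ (c : ℕ) (16≤c : 16 ≤ c) (g∣M : ∀ g → 1 ≤ g → g ≤ c → g ℕᵈ.∣ M) where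

    -- The gcd divides `b = 1 + M j`, so it is coprime to `M`. Hence it is none of the numbers
    -- `2, ..., c`, all of which divide `M`, and it divides `suc i` since it divides `M * suc i`.
    common-factor : ∀ i j → ¬ Coprime (Aᵢ i) (bⱼ j) → Σ ℕ λ t → suc (c + t) ℕᵈ.∣ suc i × suc (c + t) ℕᵈ.∣ bⱼ j
    common-factor i j ¬⊥ = g ∸ suc c ,
      subst (ℕᵈ._∣ suc i) (sym c+) (coprime-divisor {g} {M} (∣bⱼ⇒coprimeM {g} {j} g∣b) (gcd[m,n]∣m (Aᵢ i) (bⱼ j))) ,
      subst (ℕᵈ._∣ bⱼ j) (sym c+) g∣b
      where
      g = gcd (Aᵢ i) (bⱼ j)
      g∣b : g ℕᵈ.∣ bⱼ j
      g∣b = gcd[m,n]∣n (Aᵢ i) (bⱼ j)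
      1≤g : 1 ≤ g
      1≤g = ℕₚ.n≢0⇒n>0 λ g≡0 → ℕₚ.1+n≢0 (ℕᵈ.0∣⇒≡0 (subst (ℕᵈ._∣ bⱼ j) g≡0 g∣b))
      c<g : suc c ≤ g
      c<g = ℕₚ.≰⇒> λ g≤c → ¬⊥ (gcd≡1⇒coprime (∣bⱼ⇒∤M {g} {j} g∣b (g∣M g 1≤g g≤c)))
      c+ : suc c + (g ∸ suc c) ≡ g
      c+ = ℕₚ.m+[n∸m]≡n c<g

    multiples-A : ∀ P t → suc (c + t) * count P (λ i → suc (c + t) ℕᵈ.∣? suc i) ≤ suc (c + t) + P
    multiples-A P t = sparse-count suc (suc (c + t)) apart P 0
      where
      apart : ∀ o {i j} → j < i → i < suc (c + t) → suc (c + t) ℕᵈ.∣ suc (o + i) → suc (c + t) ℕᵈ.∣ suc (o + j) → ⊥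
      apart o {i} {j} j<i i<g d d′ = ∣offsets⇒⊥ j<i i<g (ℕᵈ.∣m+n∣m⇒∣n (subst (suc (c + t) ℕᵈ.∣_) eq d) d′)
        where
        eq : suc (o + i) ≡ suc (o + j) + (i ∸ j)
        eq = cong suc (trans (cong (λ t → o + t) (sym (ℕₚ.m+[n∸m]≡n (ℕₚ.<⇒≤ j<i)))) (sym (ℕₚ.+-assoc o j _)))

    multiples-A-none : ∀ P t → P < suc (c + t) → count P (λ i → suc (c + t) ℕᵈ.∣? suc i) ≡ 0
    multiples-A-none P t P<g = ℕₚ.n≤0⇒n≡0 (ℕₚ.≤-trans
      (∑-mono P λ i i<P → ℕₚ.≤-reflexive (𝟙-no (suc (c + t) ℕᵈ.∣? suc i) λ d → ℕₚ.<⇒≱ P<g (ℕₚ.≤-trans (ℕᵈ.∣⇒≤ d) i<P)))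
      (ℕₚ.≤-reflexive (∑-zero P)))

    multiples-b : ∀ H t → suc (c + t) * count H (λ j → suc (c + t) ℕᵈ.∣? bⱼ (H + j)) ≤ suc (c + t) + H
    multiples-b H t = sparse-count bⱼ g apart H H
      where
      g = suc (c + t)
      apart : ∀ o {i j} → j < i → i < g → g ℕᵈ.∣ bⱼ (o + i) → g ℕᵈ.∣ bⱼ (o + j) → ⊥
      apart o {i} {j} j<i i<g d d′ = ∣offsets⇒⊥ j<i i<g (coprime-divisor {g} {M} (∣bⱼ⇒coprimeM {g} {o + i} d)
        (ℕᵈ.∣m+n∣m⇒∣n (subst (g ℕᵈ.∣_) eq d) d′))
        where
        eq : bⱼ (o + i) ≡ bⱼ (o + j) + M * (i ∸ j)
        eq = cong suc (trans (cong (M *_) (trans (cong (λ t → o + t) (sym (ℕₚ.m+[n∸m]≡n (ℕₚ.<⇒≤ j<i)))) (sym (ℕₚ.+-assoc o j _))))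
          (ℕₚ.*-distribˡ-+ M (o + j) (i ∸ j)))

    -- A `g > P` divides no `suc i` with `i < P`. For `g ≤ P ≤ H` the rounding errors `g` are
    -- absorbed into `P` and `H`, at the cost of a factor 2 each.
    common-multiples : ∀ P H → P ≤ H → ∀ t → suc (c + t) * suc (c + t) *
      (count P (λ i → suc (c + t) ℕᵈ.∣? suc i) * count H (λ j → suc (c + t) ℕᵈ.∣? bⱼ (H + j))) ≤ 4 * (P * H)
    common-multiples P H P≤H t with suc (c + t) ≤? P
    ... | no g≰P = subst (λ n → g * g * (n * cB) ≤ 4 * (P * H)) (sym (multiples-A-none P t (ℕₚ.≰⇒> g≰P)))
      (subst (_≤ 4 * (P * H)) (sym (ℕₚ.*-zeroʳ (g * g))) z≤n)
      where
      g = suc (c + t)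
      cB = count H (λ j → suc (c + t) ℕᵈ.∣? bⱼ (H + j))
    ... | yes g≤P = begin
      g * g * (cA * cB)      ≡⟨ *-interchange g g cA cB ⟩
      g * cA * (g * cB)      ≤⟨ ℕₚ.*-mono-≤ (multiples-A P t) (multiples-b H t) ⟩
      (g + P) * (g + H)      ≤⟨ ℕₚ.*-mono-≤ (ℕₚ.+-monoˡ-≤ P g≤P) (ℕₚ.+-monoˡ-≤ H (ℕₚ.≤-trans g≤P P≤H)) ⟩
      (P + P) * (H + H)      ≡⟨ collect P H ⟩
      4 * (P * H)              ∎
      where
      open ℕₚ.≤-Reasoning
      g = suc (c + t)
      cA = count P (λ i → suc (c + t) ℕᵈ.∣? suc i)
      cB = count H (λ j → suc (c + t) ℕᵈ.∣? bⱼ (H + j))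
      collect : ∀ P H → (P + P) * (H + H) ≡ 4 * (P * H)
      collect = ℕSolver.solve-∀

    -- Union bound over common factors `g > c`: each accounts for at most `4 P H / g²` pairs, in
    -- total at most `4 P H / c`. This is where `c ≥ 16` yields a quarter.
    coprime-mostly : ∀ P H → P ≤ H →
      4 * ∑ P (λ i → count H (λ j → ¬? (coprime? (Aᵢ i) (bⱼ (H + j))))) ≤ P * H
    coprime-mostly P H P≤H = ℕₚ.*-cancelˡ-≤ 4 (begin
      4 * (4 * X)                ≡⟨ ℕₚ.*-assoc 4 4 X ⟨
      16 * X                       ≤⟨ ℕₚ.*-mono-≤ 16≤c union ⟩
      c * ∑ P (λ t → cA t * cB t) ≤⟨ ∑-inverse-squares c {{>-nonZero (ℕₚ.≤-trans (s≤s z≤n) 16≤c)}} (4 * (P * H)) (λ t → cA t * cB t) (common-multiples P H P≤H) P ⟩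
      4 * (P * H)                ∎)
      where
      open ℕₚ.≤-Reasoning
      X = ∑ P (λ i → count H (λ j → ¬? (coprime? (Aᵢ i) (bⱼ (H + j)))))
      a : ℕ → ℕ → ℕ
      a t i = 𝟙 (suc (c + t) ℕᵈ.∣? suc i)
      b : ℕ → ℕ → ℕ
      b t j = 𝟙 (suc (c + t) ℕᵈ.∣? bⱼ (H + j))
      cA cB : ℕ → ℕ
      cA t = ∑ P (a t)
      cB t = ∑ H (b t)
      pointwise : ∀ i → i < P → ∀ j → 𝟙 (¬? (coprime? (Aᵢ i) (bⱼ (H + j)))) ≤ ∑ P (λ t → a t i * b t j)
      pointwise i i<P j with ¬? (coprime? (Aᵢ i) (bⱼ (H + j)))
      ... | no _ = z≤n
      ... | yes ¬⊥ with common-factor i (H + j) ¬⊥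
      ... | t , d , d′ = ℕₚ.≤-trans
        (ℕₚ.≤-reflexive (sym (cong₂ _*_ (𝟙-yes (suc (c + t) ℕᵈ.∣? suc i) d) (𝟙-yes (suc (c + t) ℕᵈ.∣? bⱼ (H + j)) d′))))
        (∑-term P (λ t → a t i * b t j) (ℕₚ.≤-trans (s≤s (ℕₚ.m≤n+m t c)) (ℕₚ.≤-trans (ℕᵈ.∣⇒≤ d) i<P)))
      separate : ∀ t → ∑ P (λ i → ∑ H (λ j → a t i * b t j)) ≡ cA t * cB t
      separate t = trans (∑-cong P λ i → trans (∑-*ˡ H (a t i) (b t)) (ℕₚ.*-comm (a t i) (cB t)))
        (trans (∑-*ˡ P (cB t) (a t)) (ℕₚ.*-comm (cB t) (cA t)))
        where
        ∑-cong : ∀ n {f g} → (∀ i → f i ≡ g i) → ∑ n f ≡ ∑ n g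
        ∑-cong zero eq = refl
        ∑-cong (suc n) eq = cong₂ _+_ (∑-cong n eq) (eq n)
      union : X ≤ ∑ P (λ t → cA t * cB t)
      union = begin
        X ≤⟨ ∑-mono P (λ i i<P → ∑-mono H (λ j _ → pointwise i i<P j)) ⟩
        ∑ P (λ i → ∑ H (λ j → ∑ P (λ t → a t i * b t j)))
          ≤⟨ ∑-mono P (λ i _ → ℕₚ.≤-reflexive (∑-swap H P (λ j t → a t i * b t j))) ⟩
        ∑ P (λ i → ∑ P (λ t → ∑ H (λ j → a t i * b t j)))
          ≡⟨ ∑-swap P P (λ i t → ∑ H (λ j → a t i * b t j)) ⟩
        ∑ P (λ t → ∑ P (λ i → ∑ H (λ j → a t i * b t j)))
          ≤⟨ ∑-mono P (λ t _ → ℕₚ.≤-reflexive (separate t)) ⟩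
        ∑ P (λ t → cA t * cB t) ∎

  pair : ℕ × ℕ → ℕ × ℕ
  pair (i , j) = Aᵢ i , bⱼ j

  CoprimeDivisible : ℕ → ℕ × ℕ → Set
  CoprimeDivisible m (i , j) = Coprime (Aᵢ i) (bⱼ j) × m ℕᵈ.∣ value i j

  divisible-∣ : ∀ {m n} → m ℕᵈ.∣ n → ∀ {x} → CoprimeDivisible n x → CoprimeDivisible m x
  divisible-∣ m∣n r = proj₁ r , ℕᵈ.∣-trans m∣n (proj₂ r)

  -- Sort the pairs by their root modulo each large component of the common value m.
  fibre-bound : 1 ≤ k → ∀ z {m} (F : Factored m) xs →
    All (CoprimeDivisible m) xs →
    AllPairs (λ x y → ¬ LargeDivide z F (∣ Δ (pair x) (pair y) ∣)) xs → length xs ≤ k ^ #large z F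
  fibre-bound 1≤k z unit [] _ _ = z≤n
  fibre-bound 1≤k z unit (_ ∷ []) _ _ = ℕₚ.≤-refl
  fibre-bound 1≤k z unit (_ ∷ _ ∷ _) _ ((ne ∷ _) ∷ _) = ⊥-elim (ne tt)
  fibre-bound 1≤k z (component {m} p v pp p∤m F) xs vs ds with p ^ suc v ≤? z
  ... | yes _ = fibre-bound 1≤k z F xs (All.map (λ {x} → divisible-∣ (ℕᵈ.n∣m*n (p ^ suc v)) {x}) vs) ds
  ... | no _ = class-bound same? k (k ^ #large z F) spread class xs vs ds
    where
    q = p ^ suc v
    Same : ℕ × ℕ → ℕ × ℕ → Set
    Same x y = q ℕᵈ.∣ ∣ Δ (pair x) (pair y) ∣
    same? : ∀ x y → Dec (Same x y)
    same? x y = q ℕᵈ.∣? ∣ Δ (pair x) (pair y) ∣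
    Valid : ℕ × ℕ → Set
    Valid = CoprimeDivisible (q * m)
    rootAt : ∀ x → Valid x → RootAt pp v (proj₁ x) (proj₂ x)
    rootAt x = divisible-∣ (ℕᵈ.m∣m*n m) {x}
    root : ∀ x → Valid x → PrimitiveRoot p (suc v) k (pair x)
    root x r = rootAt⇒primitiveRoot pp v (proj₁ x) (proj₂ x) (rootAt x r)
    spread : ∀ xs → All Valid xs → AllPairs (λ x y → ¬ Same x y) xs → length xs ≤ k
    spread [] _ _ = z≤n
    spread xs@(x ∷ _) rs@(r ∷ _) ns = subst (_≤ k) (Listₚ.length-map pair xs)
      (roots-bounded pp v k (rootAt⇒∤odd pp v (proj₁ x) (proj₂ x) (rootAt x r)) (map pair xs)
        (Allₚ.map⁺ (All.map (λ {x} → root x) rs))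
        (AllPairsₚ.map⁺ (AllPairs.map (λ ne d → ne (∣⇒∣ᵤ d)) ns)))
    class : ∀ x xs → Valid x → All Valid xs → All (λ y → Same y x) xs →
      AllPairs (λ y y′ → ¬ (q ℕᵈ.∣ ∣ Δ (pair y) (pair y′) ∣ × LargeDivide z F ∣ Δ (pair y) (pair y′) ∣)) xs →
      length xs ≤ k ^ #large z F
    class x xs r rs sames ns = fibre-bound 1≤k z F xs
      (All.map (λ {x} → divisible-∣ (ℕᵈ.n∣m*n q) {x}) rs)
      -- Inside a class `q` divides `Δ` of any two members, so the separation hypothesis must fail
      -- at the remaining components.
      (AllPairs-map-All (λ {y} {y′} d d′ ne l → ne
        (∣⇒∣ᵤ (Δ-trans pp (suc v) (pair x) {pair y} {pair y′} ∤A (∣ᵤ⇒∣ d) (∣ᵤ⇒∣ d′)) , l)) sames ns)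
      where
      ∤A = root⇒∤A pp v k (Aᵢ (proj₁ x)) (bⱼ (proj₂ x)) (root x r)

-- Good pairs and the fibres of the value.

all-product : ∀ {P Q : ℕ → Set} {xs ys} → All P xs → All Q ys →
  All (λ x → P (proj₁ x) × Q (proj₂ x)) (cartesianProduct xs ys)
all-product [] qs = []
all-product (p ∷ ps) qs = Allₚ.++⁺ (Allₚ.map⁺ (All.map (p ,_) qs)) (all-product ps qs)

length-filter-product : ∀ {P : ℕ × ℕ → Set} (P? : ∀ x → Dec (P x)) m n →
  length (filter P? (cartesianProduct (downFrom m) (downFrom n))) ≡ ∑ m (λ i → count n (λ j → P? (i , j)))
length-filter-product P? zero n = refl
length-filter-product P? (suc m) n = begin
  length (filter P? (row ++ rest))                     ≡⟨ cong length (Listₚ.filter-++ P? row rest) ⟩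
  length (filter P? row ++ filter P? rest)             ≡⟨ Listₚ.length-++ (filter P? row) ⟩
  length (filter P? row) + length (filter P? rest)   ≡⟨ cong₂ _+_ (trans (filter-row (downFrom n)) (sym (count-filter n (λ j → P? (m , j)))))
                                                                      (length-filter-product P? m n) ⟩
  count n (λ j → P? (m , j)) + ∑ m (λ i → count n (λ j → P? (i , j))) ≡⟨ ℕₚ.+-comm (count n (λ j → P? (m , j))) (∑ m (λ i → count n (λ j → P? (i , j)))) ⟩
  ∑ (suc m) (λ i → count n (λ j → P? (i , j)))         ∎
  where
  open ≡-Reasoning
  row = map (m ,_) (downFrom n)
  rest = cartesianProduct (downFrom m) (downFrom n)
  filter-row : ∀ ys → length (filter P? (map (m ,_) ys)) ≡ length (filter (λ j → P? (m , j)) ys)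
  filter-row [] = refl
  filter-row (y ∷ ys) with P? (m , y)
  ... | yes _ = cong suc (filter-row ys)
  ... | no _ = filter-row ys

module _ (k M : ℕ) (odd∣M : odd k ℕᵈ.∣ M) (3≤k : 3 ≤ k) (1≤M : 1 ≤ M) where

  open Family k M odd∣M

  private instance
    M≢0 : NonZero M
    M≢0 = >-nonZero 1≤M

  1≤Aᵢ : ∀ i → 1 ≤ Aᵢ i
  1≤Aᵢ i = ℕₚ.*-mono-≤ 1≤M (s≤s z≤n)

  Aᵢ-mono-< : ∀ {i i′} → i < i′ → Aᵢ i < Aᵢ i′
  Aᵢ-mono-< i<i′ = ℕₚ.*-monoʳ-< M (s≤s i<i′)

  -- Equal ratios with `A < A′` force `b < b′`, and the value is increasing in both arguments.
  value≢ : ∀ {i i′ j j′} → i < i′ → Aᵢ i * Aᵢ i * bⱼ j′ ≡ Aᵢ i′ * Aᵢ i′ * bⱼ j → value i j ≢ value i′ j′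
  value≢ {i} {i′} {j} {j′} i<i′ eq = ℕₚ.<⇒≢ (strict k 3≤k)
    where
    b<b′ : bⱼ j < bⱼ j′
    b<b′ = ℕₚ.≰⇒> λ b′≤b → ℕₚ.<⇒≢ (ℕₚ.≤-<-trans (ℕₚ.*-monoʳ-≤ (Aᵢ i * Aᵢ i) b′≤b)
      (ℕₚ.*-monoˡ-< (bⱼ j) (ℕₚ.*-mono-< (Aᵢ-mono-< i<i′) (Aᵢ-mono-< i<i′)))) eq
    strict : ∀ l → 3 ≤ l → lucasℕ (Aᵢ i) (bⱼ j) (odd l) < lucasℕ (Aᵢ i′) (bⱼ j′) (odd l)
    strict (suc l) _ = lucasℕ-strict (double l) (1≤Aᵢ i) (ℕₚ.<⇒≤ (Aᵢ-mono-< i<i′)) b<b′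

  proportional⇒≡ : ∀ {i i′ j j′} → Aᵢ i * Aᵢ i * bⱼ j′ ≡ Aᵢ i′ * Aᵢ i′ * bⱼ j → value i j ≡ value i′ j′ →
    i ≡ i′ × j ≡ j′
  proportional⇒≡ {i} {i′} {j} {j′} eq veq with ℕₚ.<-cmp i i′
  ... | tri< i<i′ _ _ = ⊥-elim (value≢ {i} {i′} {j} {j′} i<i′ eq veq)
  ... | tri> _ _ i′<i = ⊥-elim (value≢ {i′} {i} {j′} {j} i′<i (sym eq) (sym veq))
  ... | tri≈ _ refl _ = refl , sym (ℕₚ.*-cancelˡ-≡ j′ j M (ℕₚ.suc-injective
    (ℕₚ.*-cancelˡ-≡ (bⱼ j′) (bⱼ j) (Aᵢ i * Aᵢ i) {{>-nonZero (ℕₚ.*-mono-≤ (1≤Aᵢ i) (1≤Aᵢ i))}} eq)))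

  module Box (c : ℕ) (16≤c : 16 ≤ c) (g∣M : ∀ g → 1 ≤ g → g ≤ c → g ℕᵈ.∣ M)
             (z : ℕ) (2≤z : 2 ≤ z) (C^e≤z : (12 * M) ^ double k ≤ z) where

    private
      instance
        z≢0 : NonZero z
        z≢0 = >-nonZero (ℕₚ.<⇒≤ 2≤z)
      1≤k : 1 ≤ k
      1≤k = ℕₚ.≤-trans (s≤s z≤n) 3≤k

    -- N is about z^{8k²}, so that P ≈ N^{1/2k} and H ≈ N^{1/k}; a pair is good when the prime powers
    -- ≤ z contribute at most Θ = H / 4 to its value.
    root P H Θ : ℕ
    root = z ^ (4 * k)
    P = 2 * root
    H = P * P
    Θ = z ^ (8 * k)

    1≤root : 1 ≤ root
    1≤root = ℕₚ.m^n>0 z (4 * k)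

    H≡4Θ : H ≡ 4 * Θ
    H≡4Θ = trans (square root) (cong (4 *_) (trans (sym (ℕₚ.^-distribˡ-+-* z (4 * k) (4 * k))) (cong (z ^_) (double-exponent k))))
      where
      square : ∀ r → 2 * r * (2 * r) ≡ 4 * (r * r)
      square = ℕSolver.solve-∀
      double-exponent : ∀ k → 4 * k + 4 * k ≡ 8 * k
      double-exponent = ℕSolver.solve-∀

    -- The range of `j` then consists of whole blocks of length `z`, as `rough-mostly` requires.
    z∣H : z ℕᵈ.∣ H
    z∣H = ℕᵈ.∣m⇒∣m*n P (ℕᵈ.∣n⇒∣m*n 2 (subst (ℕᵈ._∣ root) (ℕₚ.*-identityʳ z) (^-∣-^ z {1} {4 * k} (ℕₚ.*-mono-≤ (s≤s {n = 3} z≤n) 1≤k))))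

    P≤H : P ≤ H
    P≤H = ℕₚ.m≤m*n P P {{>-nonZero (ℕₚ.*-mono-≤ (s≤s {n = 1} z≤n) 1≤root)}}

    -- Starting `j` at `H` keeps `b` between `M H` and `2 M H`; the lower bound on `b` is what makes
    -- all values large.
    value′ : ℕ × ℕ → ℕ
    value′ (i , j) = value i (H + j)

    Good : ℕ × ℕ → Set
    Good x@(i , j) = Coprime (Aᵢ i) (bⱼ (H + j)) × smoothPart z (value′ x) ≤ Θ

    good? : ∀ x → Dec (Good x)
    good? x@(i , j) = coprime? (Aᵢ i) (bⱼ (H + j)) ×-dec (smoothPart z (value′ x) ≤? Θ)

    rough? : ∀ i j → Dec (Coprime (Aᵢ i) (bⱼ (H + j)) × Θ < smoothPart z (value i (H + j)))
    rough? i j = coprime? (Aᵢ i) (bⱼ (H + j)) ×-dec (Θ <? smoothPart z (value i (H + j)))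

    box good : List (ℕ × ℕ)
    box = cartesianProduct (downFrom P) (downFrom H)
    good = filter good? box

    rough-few : 4 * ∑ P (λ i → count H (rough? i)) ≤ P * H
    rough-few = begin
      4 * ∑ P (λ i → count H (rough? i))   ≡⟨ ∑-*ˡ P 4 (λ i → count H (rough? i)) ⟨
      ∑ P (λ i → 4 * count H (rough? i))   ≤⟨ ∑-mono P (λ i _ → each i z∣H) ⟩
      ∑ P (λ _ → H)                          ≡⟨ ∑-const P H ⟩
      P * H                                ∎
      where
      open ℕₚ.≤-Reasoning
      each : ∀ i → z ℕᵈ.∣ H → 4 * count H (rough? i) ≤ H
      each i (ℕᵈ.divides t H≡) = subst (λ h → 4 * count h (rough? i) ≤ h) (sym H≡) (rough-mostly z i 1≤k 2≤z t H)

    good-many : P * H ≤ 2 * length good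
    good-many = ℕₚ.*-cancelˡ-≤ 2 (ℕₚ.+-cancelʳ-≤ (P * H + P * H) _ _ (begin
      2 * (P * H) + (P * H + P * H) ≡⟨ four (P * H) ⟩
      4 * (P * H)                            ≤⟨ ℕₚ.*-monoʳ-≤ 4 total ⟩
      4 * (G + (X + Y))                    ≡⟨ distribute G X Y ⟩
      2 * (2 * G) + (4 * X + 4 * Y)  ≤⟨ ℕₚ.+-monoʳ-≤ (2 * (2 * G))
        (ℕₚ.+-mono-≤ (coprime-mostly k M odd∣M c 16≤c g∣M P H P≤H) rough-few) ⟩
      2 * (2 * G) + (P * H + P * H)  ∎))
      where
      open ℕₚ.≤-Reasoning
      G = length good
      X = ∑ P (λ i → count H (λ j → ¬? (coprime? (Aᵢ i) (bⱼ (H + j)))))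
      Y = ∑ P (λ i → count H (rough? i))
      four : ∀ n → 2 * n + (n + n) ≡ 4 * n
      four = ℕSolver.solve-∀
      distribute : ∀ a b c → 4 * (a + (b + c)) ≡ 2 * (2 * a) + (4 * b + 4 * c)
      distribute = ℕSolver.solve-∀
      cover : ∀ i j → 1 ≤ 𝟙 (good? (i , j)) + (𝟙 (¬? (coprime? (Aᵢ i) (bⱼ (H + j)))) + 𝟙 (rough? i j))
      cover i j = go (coprime? (Aᵢ i) (bⱼ (H + j))) (smoothPart z (value i (H + j)) ≤? Θ)
        where
        g = 𝟙 (good? (i , j))
        x = 𝟙 (¬? (coprime? (Aᵢ i) (bⱼ (H + j))))
        y = 𝟙 (rough? i j)
        go : Dec (Coprime (Aᵢ i) (bⱼ (H + j))) → Dec (smoothPart z (value i (H + j)) ≤ Θ) → 1 ≤ g + (x + y)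
        go (no ¬⊥) _ = ℕₚ.≤-trans (ℕₚ.≤-reflexive (sym (𝟙-yes (¬? (coprime? (Aᵢ i) (bⱼ (H + j)))) ¬⊥)))
          (ℕₚ.≤-trans (ℕₚ.m≤m+n x y) (ℕₚ.m≤n+m (x + y) g))
        go (yes A⊥b) (yes le) = ℕₚ.≤-trans (ℕₚ.≤-reflexive (sym (𝟙-yes (good? (i , j)) (A⊥b , le)))) (ℕₚ.m≤m+n g (x + y))
        go (yes A⊥b) (no nle) = ℕₚ.≤-trans (ℕₚ.≤-reflexive (sym (𝟙-yes (rough? i j) (A⊥b , ℕₚ.≰⇒> nle))))
          (ℕₚ.≤-trans (ℕₚ.m≤n+m y x) (ℕₚ.m≤n+m (x + y) g))
      total : P * H ≤ G + (X + Y)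
      total = begin
        P * H ≡⟨ ∑-const P H ⟨
        ∑ P (λ _ → H) ≤⟨ ∑-mono P (λ i _ → row i) ⟩
        ∑ P (λ i → g i + (x i + y i)) ≡⟨ trans (∑-+ P g (λ i → x i + y i)) (cong (λ t → ∑ P g + t) (∑-+ P x y)) ⟩
        ∑ P g + (X + Y) ≡⟨ cong (_+ (X + Y)) (sym (length-filter-product good? P H)) ⟩
        G + (X + Y) ∎
        where
        g x y : ℕ → ℕ
        g i = count H (λ j → good? (i , j))
        x i = count H (λ j → ¬? (coprime? (Aᵢ i) (bⱼ (H + j))))
        y i = count H (rough? i)
        row : ∀ i → H ≤ g i + (x i + y i)
        row i = begin
          H ≡⟨ ℕₚ.*-identityʳ H ⟨
          H * 1 ≡⟨ ∑-const H 1 ⟨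
          ∑ H (λ _ → 1) ≤⟨ ∑-mono H (λ j _ → cover i j) ⟩
          ∑ H (λ j → g′ j + (x′ j + y′ j)) ≡⟨ trans (∑-+ H g′ (λ j → x′ j + y′ j)) (cong (λ t → ∑ H g′ + t) (∑-+ H x′ y′)) ⟩
          g i + (x i + y i) ∎
          where
          g′ x′ y′ : ℕ → ℕ
          g′ j = 𝟙 (good? (i , j))
          x′ j = 𝟙 (¬? (coprime? (Aᵢ i) (bⱼ (H + j))))
          y′ j = 𝟙 (rough? i j)

    InBox : ℕ × ℕ → Set
    InBox x = proj₁ x < P × proj₂ x < H

    A≤ : ∀ {i} → i < P → Aᵢ i ≤ M * P
    A≤ i<P = ℕₚ.*-monoʳ-≤ M i<P

    b≤ : ∀ {j} → j < H → bⱼ (H + j) ≤ 2 * (M * H)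
    b≤ {j} j<H = begin
      suc (M * (H + j))    ≤⟨ ℕₚ.+-monoˡ-≤ (M * (H + j)) 1≤M ⟩
      M + M * (H + j)    ≡⟨ ℕₚ.*-suc M (H + j) ⟨
      M * suc (H + j)      ≡⟨ cong (M *_) (ℕₚ.+-suc H j) ⟨
      M * (H + suc j)      ≤⟨ ℕₚ.*-monoʳ-≤ M (ℕₚ.+-monoʳ-≤ H j<H) ⟩
      M * (H + H)          ≡⟨ doubling M H ⟩
      2 * (M * H)          ∎
      where
      open ℕₚ.≤-Reasoning
      doubling : ∀ m h → m * (h + h) ≡ 2 * (m * h)
      doubling = ℕSolver.solve-∀

    value≤ : ∀ x → InBox x → value′ x ≤ (12 * M * root) ^ double k
    -- `Y = 3 M P` dominates `A`, satisfies `Y² ≥ 2 M H ≥ b`, and gives `2 Y = 12 M root`.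
    value≤ (i , j) (i<P , j<H) = subst (λ y → value i (H + j) ≤ y ^ double k) (collect M root)
      (lucasℕ≤ (3 * (M * P)) (double k) (ℕₚ.≤-trans (A≤ i<P) (ℕₚ.m≤n*m (M * P) 3)) b≤Y²)
      where
      open ℕₚ.≤-Reasoning
      collect : ∀ m r → 2 * (3 * (m * (2 * r))) ≡ 12 * m * r
      collect = ℕSolver.solve-∀
      square : ∀ m p → 9 * m * (m * (p * p)) ≡ 3 * (m * p) * (3 * (m * p))
      square = ℕSolver.solve-∀
      b≤Y² : bⱼ (H + j) ≤ 3 * (M * P) * (3 * (M * P))
      b≤Y² = begin
        bⱼ (H + j)             ≤⟨ b≤ j<H ⟩
        2 * (M * H)          ≤⟨ ℕₚ.*-monoˡ-≤ (M * H) (ℕₚ.≤-trans (s≤s (s≤s z≤n)) (ℕₚ.*-monoʳ-≤ 9 1≤M)) ⟩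
        9 * M * (M * H)    ≡⟨ square M P ⟩
        3 * (M * P) * (3 * (M * P)) ∎

    1≤value : ∀ i j → 1 ≤ value i j
    1≤value i j = lucasℕ-pos (bⱼ j) (double k) (1≤Aᵢ i)

    -- The hypothesis `3 ≤ k`, that is `n ≥ 7`, enters here: the monomial `b ^ k` already gives
    -- `b³`, one factor `H` more than `scale`.
    [MH]³≤value : ∀ i j → (M * H) ^ 3 ≤ value i (H + j)
    [MH]³≤value i j = begin
      (M * H) ^ 3              ≤⟨ ℕₚ.^-monoˡ-≤ 3 (ℕₚ.m≤n⇒m≤1+n (ℕₚ.*-monoʳ-≤ M (ℕₚ.m≤m+n H j))) ⟩
      bⱼ (H + j) ^ 3           ≤⟨ ℕₚ.^-monoʳ-≤ (bⱼ (H + j)) 3≤k ⟩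
      bⱼ (H + j) ^ k           ≤⟨ b^k≤lucasℕ (Aᵢ i) (bⱼ (H + j)) k ⟩
      value i (H + j)            ∎
      where open ℕₚ.≤-Reasoning

    -- The size of `A² b′` on the box up to a factor 2, from `A ≤ M P`, `P² = H` and `b′ ≤ 2 M H`.
    scale : ℕ
    scale = M * M * M * (H * H)

    cross≤ : ∀ {i j} → i < P → j < H → Aᵢ i * Aᵢ i * bⱼ (H + j) ≤ 2 * scale
    cross≤ {i} {j} i<P j<H = ℕₚ.≤-trans (ℕₚ.*-mono-≤ (ℕₚ.*-mono-≤ (A≤ i<P) (A≤ i<P)) (b≤ j<H)) (ℕₚ.≤-reflexive (collect M P H))
      where
      collect : ∀ m p h → m * p * (m * p) * (2 * (m * h)) ≡ 2 * (m * m * m * (p * p * h))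
      collect = ℕSolver.solve-∀

    shift : ℕ × ℕ → ℕ × ℕ
    shift (i , j) = i , H + j

    shifted : ℕ × ℕ → ℕ × ℕ
    shifted x = pair k M odd∣M (shift x)

    -- The large part of a good value exceeds every nonzero Δ of the box.
    large-separates : ∀ {v} (F : Factored v) x y → InBox x → InBox y → Good x → value′ x ≡ v → value′ y ≡ v →
      LargeDivide z F ∣ Δ (shifted x) (shifted y) ∣ → x ≡ y
    large-separates F x@(i , j) y@(i′ , j′) (i< , j<) (i′< , j′<) (_ , smooth≤) refl eq div with ∣ Δ (shifted x) (shifted y) ∣ in eqΔ
    ... | zero with proportional⇒≡ {i} {i′} {H + j} {H + j′} (Δ≡0⇒ {Aᵢ i} {bⱼ (H + j)} {Aᵢ i′} {bⱼ (H + j′)} (ℤₚ.∣i∣≡0⇒i≡0 eqΔ)) (sym eq)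
    ...   | i≡i′ , j≡j′ = cong₂ _,_ i≡i′ (ℕₚ.+-cancelˡ-≡ H j j′ j≡j′)
    -- If `Δ` is nonzero, it bounds the large part by `2 * scale`; with a small part of at most `Θ`
    -- the value is at most `2 Θ * scale`, against the lower bound `scale * H = 4 Θ * scale`.
    large-separates F x@(i , j) y@(i′ , j′) (i< , j<) (i′< , j′<) (_ , smooth≤) refl eq div
      | d@(suc _) = ⊥-elim (ℕₚ.<⇒≱ 2Θ<4Θ (begin
        scale * (4 * Θ)      ≡⟨ cong (scale *_) H≡4Θ ⟨
        scale * H              ≡⟨ cube M H ⟩
        (M * H) ^ 3          ≤⟨ [MH]³≤value i j ⟩
        value′ x                 ≡⟨ small*large z F ⟨
        small z F * large z F  ≤⟨ ℕₚ.*-mono-≤ (ℕₚ.≤-trans (small≤smoothPart z F) smooth≤) (ℕᵈ.∣⇒≤ (large∣ z F d div)) ⟩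
        Θ * d                  ≤⟨ ℕₚ.*-monoʳ-≤ Θ d≤ ⟩
        Θ * (2 * scale)      ∎))
      where
      open ℕₚ.≤-Reasoning
      d≤ : d ≤ 2 * scale
      d≤ = subst (_≤ 2 * scale) eqΔ
        (∣Δ∣≤ {Aᵢ i} {bⱼ (H + j)} {Aᵢ i′} {bⱼ (H + j′)} (2 * scale) (cross≤ i< j′<) (cross≤ i′< j<))
      cube : ∀ m h → m * m * m * (h * h) * h ≡ m * h * (m * h * (m * h * 1))
      cube = ℕSolver.solve-∀
      collect : ∀ t s → t * (2 * s) ≡ 2 * (s * t)
      collect = ℕSolver.solve-∀
      collect′ : ∀ t s → 4 * (s * t) ≡ s * (4 * t)
      collect′ = ℕSolver.solve-∀
      1≤H : 1 ≤ H
      1≤H = ℕₚ.≤-trans (s≤s z≤n) j<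
      1≤scale*Θ : 1 ≤ scale * Θ
      1≤scale*Θ = ℕₚ.*-mono-≤ (ℕₚ.*-mono-≤ (ℕₚ.*-mono-≤ (ℕₚ.*-mono-≤ 1≤M 1≤M) 1≤M) (ℕₚ.*-mono-≤ 1≤H 1≤H)) (ℕₚ.m^n>0 z (8 * k))
      2Θ<4Θ : Θ * (2 * scale) < scale * (4 * Θ)
      2Θ<4Θ = subst₂ _<_ (sym (collect Θ scale)) (collect′ Θ scale)
        (ℕₚ.*-monoˡ-< (scale * Θ) {{>-nonZero 1≤scale*Θ}} (ℕₚ.m≤m+n 3 1))

    exponent : ℕ
    exponent = suc (4 * k * double k)

    -- Every large component exceeds `z`, while `v` is at most `(12 M) ^ (2k)` times a power of `z`;
    -- by `C^e≤z` the constant costs a single further factor `z`.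
    #large≤ : ∀ {v} (F : Factored v) → 1 ≤ v → v ≤ (12 * M * root) ^ double k → #large z F ≤ exponent
    #large≤ {v} F 1≤v v≤ = ℕₚ.≮⇒≥ λ lt → ℕₚ.<⇒≱ (ℕₚ.^-monoʳ-< z 2≤z lt) (begin
      z ^ #large z F                        ≤⟨ z^#large≤large z F ⟩
      large z F                               ≤⟨ ℕᵈ.∣⇒≤ {{>-nonZero 1≤v}} (ℕᵈ.divides (small z F) (sym (small*large z F))) ⟩
      v                                       ≤⟨ v≤ ⟩
      (12 * M * root) ^ double k        ≡⟨ *-^-distrib (12 * M) root (double k) ⟩
      (12 * M) ^ double k * root ^ double k ≤⟨ ℕₚ.*-monoˡ-≤ (root ^ double k) C^e≤z ⟩
      z * root ^ double k                 ≡⟨ cong (z *_) (ℕₚ.^-*-assoc z (4 * k) (double k)) ⟩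
      z ^ exponent                          ∎)
      where open ℕₚ.≤-Reasoning

    fibre : ∀ v xs → All (λ x → InBox x × Good x) xs → All (λ x → value′ x ≡ v) xs → AllPairs _≢_ xs →
      length xs ≤ k ^ exponent
    fibre v [] _ _ _ = z≤n
    fibre v xs@(x ∷ _) vs@((box-x , _) ∷ _) es@(refl ∷ _) ds = begin
      length xs                  ≡⟨ Listₚ.length-map shift xs ⟨
      length (map shift xs)      ≤⟨ fibre-bound k M odd∣M 1≤k z F (map shift xs)
        (Allₚ.map⁺ (All.zipWith (λ {x} → divisible {x}) (vs , es)))
        (AllPairsₚ.map⁺ (AllPairs-map-All (λ {x} {y} → separate {x} {y}) (All.zip (vs , es)) ds)) ⟩
      k ^ #large z F           ≤⟨ ℕₚ.^-monoʳ-≤ k {{>-nonZero 1≤k}} (#large≤ F 1≤v (value≤ x box-x)) ⟩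
      k ^ exponent             ∎
      where
      open ℕₚ.≤-Reasoning
      1≤v : 1 ≤ value′ x
      1≤v = 1≤value (proj₁ x) (H + proj₂ x)
      F : Factored (value′ x)
      F = factored (value′ x) {{>-nonZero 1≤v}}
      divisible : ∀ {y} → (InBox y × Good y) × value′ y ≡ value′ x → CoprimeDivisible k M odd∣M (value′ x) (shift y)
      divisible {y} ((_ , g) , eq) = proj₁ g , subst (value′ x ℕᵈ.∣_) (sym eq) ℕᵈ.∣-refl
      separate : ∀ {y y′} → (InBox y × Good y) × value′ y ≡ value′ x → (InBox y′ × Good y′) × value′ y′ ≡ value′ x →
        y ≢ y′ → ¬ LargeDivide z F ∣ Δ (shifted y) (shifted y′) ∣
      separate {y} {y′} ((b , g) , e) ((b′ , _) , e′) y≢y′ div = y≢y′ (large-separates F y y′ b b′ g e e′ div)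

    box-inBox : All InBox box
    box-inBox = all-product (Allₚ.applyDownFrom⁺₁ (λ i → i) P (λ lt → lt)) (Allₚ.applyDownFrom⁺₁ (λ j → j) H (λ lt → lt))

    good-unique : Unique good
    good-unique = Uniqueₚ.filter⁺ good? (Uniqueₚ.cartesianProduct⁺ (Uniqueₚ.downFrom⁺ P) (Uniqueₚ.downFrom⁺ H))

    Attained : ℕ → Set
    Attained v = v ≤ (12 * M * root) ^ double k × Σ ℕ λ i → Σ ℕ λ j → value i j ≡ v

    many-values : Σ (List ℕ) λ ys → Unique ys × All Attained ys ×
      root * (root * root) ≤ k ^ exponent * length ys
    many-values = collect-values (distinct-values value′ (k ^ exponent) fibre good
      (All.zip (inBox , Allₚ.all-filter good? box)) good-unique)
      where
      inBox : All InBox good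
      inBox = Allₚ.filter⁺ good? box-inBox
      attained : ∀ {x} → InBox x → Attained (value′ x)
      attained {x} b = value≤ x b , proj₁ x , H + proj₂ x , refl
      eight : ∀ r → 2 * r * (2 * r * (2 * r)) ≡ 2 * (4 * (r * (r * r)))
      eight = ℕSolver.solve-∀
      enough : root * (root * root) ≤ length good
      enough = ℕₚ.≤-trans (ℕₚ.m≤n*m (root * (root * root)) 4)
        (ℕₚ.*-cancelˡ-≤ 2 (ℕₚ.≤-trans (ℕₚ.≤-reflexive (sym (eight root))) good-many))
      collect-values : (Σ (List ℕ) λ ys → AllPairs _≢_ ys × (∀ {Q : ℕ → Set} → All (Q ∘ value′) good → All Q ys) ×
        length good ≤ k ^ exponent * length ys) → Σ (List ℕ) λ ys → Unique ys × All Attained ys ×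
        root * (root * root) ≤ k ^ exponent * length ys
      collect-values (ys , ys! , all , bound) =
        ys , ys! , all {Attained} (All.map (λ {x} → attained {x}) inBox) , ℕₚ.≤-trans enough bound

-- From the box sizes to every `N`.

-- Since `x ≤ g x`, the search passes `N` within `N + 1` steps, which is the fuel supplied.
bracket : ∀ (g : ℕ → ℕ) → (∀ x → x ≤ g x) → ∀ z₀ N → g z₀ ≤ N → Σ ℕ λ z → z₀ ≤ z × g z ≤ N × N < g (suc z)
bracket g x≤gx z₀ N le = search (suc N) z₀ le (ℕₚ.m≤m+n (suc N) z₀)
  where
  search : ∀ fuel z → g z ≤ N → N < fuel + z → Σ ℕ λ z′ → z ≤ z′ × g z′ ≤ N × N < g (suc z′)
  search zero z le lt = ⊥-elim (ℕₚ.<⇒≱ (ℕₚ.<-≤-trans lt (x≤gx z)) le)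
  search (suc fuel) z le lt with N <? g (suc z)
  ... | yes N<g = z , ℕₚ.≤-refl , le , N<g
  ... | no N≮g with search fuel (suc z) (ℕₚ.≮⇒≥ N≮g) (subst (N <_) (sym (ℕₚ.+-suc fuel z)) lt)
  ...   | z′ , z<z′ , le′ , lt′ = z′ , ℕₚ.<⇒≤ z<z′ , le′ , lt′

a≤a^n : ∀ a {n} → 1 ≤ n → a ≤ a ^ n
a≤a^n zero 1≤n = z≤n
a≤a^n a@(suc _) 1≤n = ℕₚ.≤-trans (ℕₚ.≤-reflexive (sym (ℕₚ.*-identityʳ a))) (ℕₚ.^-monoʳ-≤ a 1≤n)

-- The constant is the rational `p / q`, and the inequality is raised to the power `n - 1` to clear
-- the exponent `3/(n-1)`. A duplicate-free list of members bounds the cardinality from below.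
Bounds : ℕ → Set
Bounds n = Σ ℕ λ p → Σ ℕ λ q → 1 ≤ p × 1 ≤ q ×
  ((N : ℕ) → 1 ≤ N → Σ ℕ (λ x → InL n N x) →
    Σ (List ℕ) λ xs → Unique xs × All (InL n N) xs ×
      p ^ (n ∸ 1) * N ^ 3 ≤ (q * length xs) ^ (n ∸ 1)) ×
  ((N : ℕ) → 1 ≤ N → Σ ℕ (λ x → InLge n N x) →
    Σ (List ℕ) λ xs → Unique xs × All (InLge n N) xs ×
      p ^ (n ∸ 1) * N ^ 3 ≤ (q * length xs) ^ (n ∸ 1))

module _ (k M : ℕ) (odd∣M : odd k ℕᵈ.∣ M) (3≤k : 3 ≤ k) (1≤M : 1 ≤ M)
         (divides-M : ∀ d → 1 ≤ d → d ≤ 16 → d ℕᵈ.∣ M) where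

  private
    n e C K z₀ N₀ : ℕ
    n = odd k
    e = double k
    C = 12 * M
    K = k ^ suc (4 * k * e)
    -- Meets both demands of `Box` on `z`: at least 2 and at least `(12 M) ^ (2k)`.
    z₀ = 2 + C ^ e

    root g : ℕ → ℕ
    root z = z ^ (4 * k)
    g z = (C * root z) ^ e
    N₀ = g z₀

    c q : ℕ
    -- `root 2` pays for passing from `z` to `suc z ≤ 2 z`. In `q` the first summand serves
    -- `N ≥ N₀`; the summand `N₀ ^ 3` serves `N < N₀`, where a single member has to suffice.
    c = C * root 2
    q = c * (c * c) * K + N₀ ^ 3

    1≤C : 1 ≤ C
    1≤C = ℕₚ.≤-trans 1≤M (ℕₚ.m≤n*m M 12)

    1≤k : 1 ≤ k
    1≤k = ℕₚ.≤-trans (s≤s z≤n) 3≤k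

    k≤double : ∀ l → l ≤ double l
    k≤double zero = z≤n
    k≤double (suc l) = s≤s (ℕₚ.m≤n⇒m≤1+n (k≤double l))

    1≤e : 1 ≤ e
    1≤e = ℕₚ.≤-trans 1≤k (k≤double k)

    1≤4k : 1 ≤ 4 * k
    1≤4k = ℕₚ.≤-trans 1≤k (ℕₚ.m≤n*m k 4)

    x≤gx : ∀ x → x ≤ g x
    x≤gx x = ℕₚ.≤-trans (a≤a^n x 1≤4k) (ℕₚ.≤-trans (ℕₚ.m≤n*m (root x) C {{>-nonZero 1≤C}}) (a≤a^n _ 1≤e))

    g-doubling : ∀ z → 1 ≤ z → g (suc z) ≤ (c * root z) ^ e
    g-doubling z 1≤z = ℕₚ.^-monoˡ-≤ e (begin
      C * root (suc z)          ≤⟨ ℕₚ.*-monoʳ-≤ C (ℕₚ.^-monoˡ-≤ (4 * k) (ℕₚ.≤-trans (ℕₚ.+-monoˡ-≤ z 1≤z) (ℕₚ.+-monoʳ-≤ z (ℕₚ.m≤m+n z 0)))) ⟩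
      C * root (2 * z)        ≡⟨ cong (C *_) (*-^-distrib 2 z (4 * k)) ⟩
      C * (root 2 * root z)   ≡⟨ ℕₚ.*-assoc C (root 2) (root z) ⟨
      c * root z                ∎)
      where open ℕₚ.≤-Reasoning

    ^-^3 : ∀ a → (a ^ e) ^ 3 ≡ (a * (a * a)) ^ e
    ^-^3 a = begin
      a ^ e * (a ^ e * (a ^ e * 1)) ≡⟨ cong (λ t → a ^ e * (a ^ e * t)) (ℕₚ.*-identityʳ (a ^ e)) ⟩
      a ^ e * (a ^ e * a ^ e)         ≡⟨ cong (a ^ e *_) (*-^-distrib a a e) ⟨
      a ^ e * (a * a) ^ e               ≡⟨ *-^-distrib a (a * a) e ⟨
      (a * (a * a)) ^ e                   ∎
      where open ≡-Reasoning

    count-bound-large : ∀ N z L → 1 ≤ z → N < g (suc z) → root z * (root z * root z) ≤ K * L →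
      N ^ 3 ≤ (q * L) ^ e
    count-bound-large N z L 1≤z N<g le = begin
      N ^ 3                                  ≤⟨ ℕₚ.^-monoˡ-≤ 3 (ℕₚ.≤-trans (ℕₚ.<⇒≤ N<g) (g-doubling z 1≤z)) ⟩
      ((c * r) ^ e) ^ 3                  ≡⟨ ^-^3 (c * r) ⟩
      (c * r * (c * r * (c * r))) ^ e ≤⟨ ℕₚ.^-monoˡ-≤ e (begin
        c * r * (c * r * (c * r))     ≡⟨ regroup c r ⟩
        c * (c * c) * (r * (r * r))   ≤⟨ ℕₚ.*-monoʳ-≤ (c * (c * c)) le ⟩
        c * (c * c) * (K * L)           ≡⟨ ℕₚ.*-assoc (c * (c * c)) K L ⟨
        c * (c * c) * K * L             ≤⟨ ℕₚ.*-monoˡ-≤ L (ℕₚ.m≤m+n (c * (c * c) * K) (N₀ ^ 3)) ⟩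
        q * L                                 ∎) ⟩
      (q * L) ^ e                          ∎
      where
      open ℕₚ.≤-Reasoning
      r = root z
      regroup : ∀ c r → c * r * (c * r * (c * r)) ≡ c * (c * c) * (r * (r * r))
      regroup = ℕSolver.solve-∀

    1≤q : 1 ≤ q
    1≤q = ℕₚ.≤-trans (ℕₚ.m^n>0 N₀ {{>-nonZero (ℕₚ.≤-trans (s≤s z≤n) (x≤gx z₀))}} 3) (ℕₚ.m≤n+m (N₀ ^ 3) (c * (c * c) * K))

    1^e*N : ∀ N → 1 ^ e * N ≡ N
    1^e*N N = trans (cong (_* N) (ℕₚ.^-zeroˡ e)) (ℕₚ.*-identityˡ N)

    module _ (Q : ℕ → Set) (N : ℕ) (incl : ∀ {x} → InL n N x → Q x) where

      Many : Set
      Many = Σ (List ℕ) λ xs → Unique xs × All Q xs × 1 ^ e * N ^ 3 ≤ (q * length xs) ^ e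

      -- For bounded `N` the member granted by non-emptiness is the whole list.
      many-below : N < N₀ → Σ ℕ Q → Many
      many-below N<N₀ (x , Qx) = x ∷ [] , [] ∷ [] , Qx ∷ [] , (begin
        1 ^ e * N ^ 3    ≡⟨ 1^e*N (N ^ 3) ⟩
        N ^ 3                ≤⟨ ℕₚ.^-monoˡ-≤ 3 (ℕₚ.<⇒≤ N<N₀) ⟩
        N₀ ^ 3               ≤⟨ ℕₚ.m≤n+m (N₀ ^ 3) (c * (c * c) * K) ⟩
        q                      ≡⟨ ℕₚ.*-identityʳ q ⟨
        q * 1                ≤⟨ a≤a^n (q * 1) 1≤e ⟩
        (q * 1) ^ e        ∎)
        where open ℕₚ.≤-Reasoning

      inL : ∀ {v z} → g z ≤ N →
        (v ≤ g z × Σ ℕ λ i → Σ ℕ λ j → lucasℕ (M * suc i) (suc (M * j)) n ≡ v) → Q v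
      inL gz≤N (v≤ , i , j , eq) = incl (ℕₚ.≤-trans v≤ gz≤N , + (M * suc i) , - + suc (M * j) ,
        nonDegenerate (ℕₚ.*-mono-≤ 1≤M (s≤s {n = i} z≤n)) (s≤s z≤n) ,
        trans (∣U∣-lucasℕ (M * suc i) (suc (M * j)) n) eq)

      many-at : ∀ z → z₀ ≤ z → g z ≤ N → N < g (suc z) →
        (Σ (List ℕ) λ ys → Unique ys ×
          All (λ v → v ≤ g z × Σ ℕ λ i → Σ ℕ λ j → lucasℕ (M * suc i) (suc (M * j)) n ≡ v) ys ×
          root z * (root z * root z) ≤ K * length ys) → Many
      many-at z z₀≤z gz≤N N<g (ys , ys! , all , bound) = ys , ys! , All.map (λ {v} → inL {v} {z} gz≤N) all ,
        subst (_≤ (q * length ys) ^ e) (sym (1^e*N (N ^ 3)))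
          (count-bound-large N z (length ys) (ℕₚ.≤-trans (s≤s z≤n) z₀≤z) N<g bound)

      many-above : (Σ ℕ λ z → z₀ ≤ z × g z ≤ N × N < g (suc z)) → Many
      many-above (z , z₀≤z , gz≤N , N<g) = many-at z z₀≤z gz≤N N<g
        (Box.many-values k M odd∣M 3≤k 1≤M 16 ℕₚ.≤-refl divides-M z (ℕₚ.≤-trans (ℕₚ.m≤m+n 2 (C ^ e)) z₀≤z)
          (ℕₚ.≤-trans (ℕₚ.m≤n+m (C ^ e) 2) z₀≤z))

      many : Σ ℕ Q → Many
      many x = decide (ℕₚ.≤-<-connex N₀ N)
        where
        decide : N₀ ≤ N ⊎ N < N₀ → Many
        decide (inj₁ N₀≤N) = many-above (bracket g x≤gx z₀ N N₀≤N)
        decide (inj₂ N<N₀) = many-below N<N₀ x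

  lower-bounds : Bounds n
  lower-bounds = 1 , q , ℕₚ.≤-refl , 1≤q ,
    (λ N _ → many (InL n N) N (λ l → l)) ,
    (λ N _ → many (InLge n N) N (λ l → n , ℕₚ.≤-refl , l))

1+2*≡odd : ∀ k → 1 + 2 * k ≡ odd k
1+2*≡odd k = cong suc (2*≡double k)
  where
  2*≡double : ∀ k → 2 * k ≡ double k
  2*≡double zero = refl
  2*≡double (suc k) = cong suc (trans (ℕₚ.+-suc k (k + 0)) (cong suc (2*≡double k)))

-- `M = n * m !` is divisible by `n` and by every `d ≤ 16`. With `m` a variable, `m !` stays
-- unevaluated here.
lower-bounds-odd : ∀ k → 3 ≤ k → ∀ m → 16 ≤ m → Bounds (odd k)
lower-bounds-odd k 3≤k m 16≤m =
  lower-bounds k (odd k * m !) (ℕᵈ.m∣m*n (m !)) 3≤k (ℕₚ.*-mono-≤ {1} {odd k} (s≤s z≤n) (ℕₚ.1≤n! m)) small-divides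
  where
  small-divides : ∀ d → 1 ≤ d → d ≤ 16 → d ℕᵈ.∣ odd k * m !
  small-divides d@(suc d′) _ d≤16 =
    ℕᵈ.∣n⇒∣m*n (odd k) (ℕᵈ.∣-trans (ℕᵈ.m∣m*n (d′ !)) (ℕᵈ.m≤n⇒m!∣n! (ℕₚ.≤-trans d≤16 16≤m)))

theorem2p5 : (n : ℕ) → 7 ≤ n → Σ ℕ (λ k → n ≡ 1 + 2 * k) →
    Σ ℕ λ p → Σ ℕ λ q → 1 ≤ p × 1 ≤ q ×
    ((N : ℕ) → 1 ≤ N → Σ ℕ (λ x → InL n N x) →
    Σ (List ℕ) λ xs → Unique xs × All (InL n N) xs ×
    p ^ (n ∸ 1) * N ^ 3 ≤ (q * length xs) ^ (n ∸ 1)) ×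
    ((N : ℕ) → 1 ≤ N → Σ ℕ (λ x → InLge n N x) →
    Σ (List ℕ) λ xs → Unique xs × All (InLge n N) xs ×
    p ^ (n ∸ 1) * N ^ 3 ≤ (q * length xs) ^ (n ∸ 1))
theorem2p5 n 7≤n (k , refl) = subst Bounds (sym (1+2*≡odd k))
  (lower-bounds-odd k (ℕₚ.*-cancelˡ-≤ 2 (ℕₚ.≤-pred 7≤n)) 16 ℕₚ.≤-refl)
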